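{- Let $q$, $a$ and $b$ be integers such that $q \geq 2$, $a \geq 1$ and $b \geq -a$, and let $(v_n)_{n \in \mathbb{N}}$ be the sequence of natural numbers whose general term is $v_n = a q^n + b$ for all $n \in \mathbb{N}$. Suppose that $\gcd(a q, b) = \gcd(a + b, q - 1) = 1$ and set $$B' := \max\left(a (q - 1), \frac{b (q - 1) + 1}{2}\right).$$ Then, for any positive integer $n$, we have $$\mathrm{lcm}\{v_1, v_2, \dots, v_n\} \geq (a q + b) \left(\frac{a (q - 1) + 1}{2 \sqrt{B'}}\right)^{n - 1} q^{\frac{(n - 1)(n - 4)}{4}}.$$
   Context: $\mathbb{N}$ is the set of non-negative integers. -}

module Defs where

open import Data.Empty using (⊥-elim)
open import Data.Integer.Base as ℤ using (ℤ; +_; -[1+_])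
import Data.Integer.Properties as ℤ
open import Data.Integer.LCM using (lcm)
open import Data.Nat.Base as ℕ using (ℕ; zero; suc)
import Data.Nat.Properties as ℕ
import Data.Nat.LCM as ℕL
import Data.Nat.GCD as ℕG
open import Data.Product.Base using (_×_; _,_; proj₁; proj₂; ∃; ∃₂)
open import Data.Rational.Base
  using (ℚ; mkℚ; 0ℚ; 1ℚ; _<_; _≤_; _+_; _-_; _*_; -_; _/_; _⊔_; 1/_; positive; nonNegative; toℚᵘ)
open import Data.Rational.Properties
import Data.Rational.Unnormalised.Base as ℚᵘ
import Data.Rational.Unnormalised.Properties as ℚᵘ
open import Data.Rational.Solver using (module +-*-Solver)
open import Data.Sum.Base using (_⊎_; inj₁; inj₂; [_,_]′)
open import Relation.Binary.PropositionalEquality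
open import Relation.Binary.Definitions using (tri<; tri≈; tri>)
open import Relation.Nullary using (¬_; yes; no)
open +-*-Solver

module ℚ-Lemmas where

  ×-monoˡ : ∀ {r p q} → 0ℚ < r → p < q → r * p < r * q
  ×-monoˡ {r} 0<r = *-monoʳ-<-pos r {{positive 0<r}}

  ×-monoʳ : ∀ {r p q} → 0ℚ < r → p < q → p * r < q * r
  ×-monoʳ {r} 0<r = *-monoˡ-<-pos r {{positive 0<r}}

  ×-mono : ∀ {p q r s} → 0ℚ < p → 0ℚ < s → p < q → r < s → p * r < q * s
  ×-mono 0<p 0<s p<q r<s = <-trans (×-monoˡ 0<p r<s) (×-monoʳ 0<s p<q)

  ×-pos : ∀ {p q} → 0ℚ < p → 0ℚ < q → 0ℚ < p * q
  ×-pos {p} {q} 0<p 0<q = subst (_< p * q) (*-zeroʳ p) (×-monoˡ 0<p 0<q)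

  sq-mono : ∀ {p q} → 0ℚ < p → p < q → p * p < q * q
  sq-mono 0<p p<q = ×-mono 0<p (<-trans 0<p p<q) p<q p<q

  0<1 : 0ℚ < 1ℚ
  0<1 = positive⁻¹ 1ℚ

  p<p+ : ∀ {p q} → 0ℚ < q → p < p + q
  p<p+ {p} {q} 0<q = subst (_< p + q) (+-identityʳ p) (+-monoʳ-< p 0<q)

  p<q⇒0<q-p : ∀ {p q} → p < q → 0ℚ < q - p
  p<q⇒0<q-p {p} {q} p<q = subst (_< q - p) (+-inverseʳ p) (+-monoˡ-< (- p) p<q)

  recip : ∀ {p} → 0ℚ < p → ∃ λ c → 0ℚ < c × c * p ≡ 1ℚ
  recip {p} 0<p = 1/p , positive⁻¹ 1/p {{1/pos⇒pos p {{positive 0<p}}}} , *-inverseˡ p {{nz}}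
    where
    nz = pos⇒nonZero p {{positive 0<p}}
    1/p = (1/ p) {{nz}}

  -- The harmonic mean 2t/(1+t) of 1 and t squares to less than t.
  between-1-and-√ : ∀ {t} → 1ℚ < t → ∃ λ σ → 1ℚ < σ × σ * σ < t
  between-1-and-√ {t} 1<t =
    σ , subst (_< σ) c1t 1<σ′ , *-cancelʳ-<-nonNeg (u * u) {{nonNeg}} lt
    where
    0<t = <-trans 0<1 1<t
    u = 1ℚ + t
    0<u : 0ℚ < u
    0<u = <-trans 0<1 (p<p+ 0<t)
    c = proj₁ (recip 0<u)
    0<c = proj₁ (proj₂ (recip 0<u))
    c1t : c * u ≡ 1ℚ
    c1t = proj₂ (proj₂ (recip 0<u))
    σ = c * (t + t)
    1<σ′ : c * u < σ
    1<σ′ = ×-monoˡ 0<c (+-monoˡ-< t 1<t)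
    nonNeg = nonNegative (<⇒≤ (×-pos 0<u 0<u))
    d = t - 1ℚ
    0<d² : 0ℚ < d * d
    0<d² = ×-pos (p<q⇒0<q-p 1<t) (p<q⇒0<q-p 1<t)
    eq₁ : σ * σ * (u * u) ≡ (t + t) * (t + t)
    eq₁ = trans
      (solve 3 (λ c u w → (c :* w) :* (c :* w) :* (u :* u) := (c :* u) :* (c :* u) :* (w :* w)) refl c u (t + t))
      (trans (cong (λ z → z * z * ((t + t) * (t + t))) c1t) (*-identityˡ _))
    eq₂ : (t + t) * (t + t) + t * (d * d) ≡ t * (u * u)
    eq₂ = solve 1 (λ t → (t :+ t) :* (t :+ t) :+ t :* ((t :- con 1ℚ) :* (t :- con 1ℚ))
                         := t :* ((con 1ℚ :+ t) :* (con 1ℚ :+ t))) refl t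
    lt : σ * σ * (u * u) < t * (u * u)
    lt = subst₂ _<_ (sym eq₁) eq₂ (p<p+ (×-pos 0<t 0<d²))

  pow : ℚ → ℕ → ℚ
  pow p zero    = 1ℚ
  pow p (suc n) = p * pow p n

  mult : ℕ → ℚ → ℚ
  mult zero    p = 0ℚ
  mult (suc n) p = p + mult n p

  mult-distrib : ∀ n p q → mult n p * q ≡ mult n (p * q)
  mult-distrib zero    p q = *-zeroˡ q
  mult-distrib (suc n) p q =
    trans (*-distribʳ-+ q p (mult n p)) (cong (_+_ (p * q)) (mult-distrib n p q))

  mult-0≤ : ∀ n {p} → 0ℚ < p → 0ℚ ≤ mult n p
  mult-0≤ zero    0<p = ≤-refl
  mult-0≤ (suc n) 0<p = +-mono-≤ (<⇒≤ 0<p) (mult-0≤ n 0<p)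

  bernoulli : ∀ {σ} → 1ℚ < σ → ∀ n → 1ℚ + mult n (σ - 1ℚ) ≤ pow σ n
  bernoulli 1<σ zero = ≤-refl
  bernoulli {σ} 1<σ (suc n) = ≤-trans step
    (*-monoˡ-≤-nonNeg σ {{nonNegative (<⇒≤ (<-trans 0<1 1<σ))}} (bernoulli 1<σ n))
    where
    δ = σ - 1ℚ
    m = mult n δ
    0≤δm : 0ℚ ≤ δ * m
    0≤δm = subst (_≤ δ * m) (*-zeroʳ δ)
      (*-monoˡ-≤-nonNeg δ {{nonNegative (<⇒≤ (p<q⇒0<q-p 1<σ))}} (mult-0≤ n (p<q⇒0<q-p 1<σ)))
    eq : (1ℚ + (δ + m)) + δ * m ≡ σ * (1ℚ + m)
    eq = solve 2 (λ s m → (con 1ℚ :+ ((s :- con 1ℚ) :+ m)) :+ (s :- con 1ℚ) :* m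
                          := s :* (con 1ℚ :+ m)) refl σ m
    step : 1ℚ + (δ + m) ≤ σ * (1ℚ + m)
    step = subst₂ _≤_ (+-identityʳ _) eq (+-monoʳ-≤ (1ℚ + (δ + m)) 0≤δm)

  toℚᵘ-mult : ∀ n → toℚᵘ (mult n 1ℚ) ℚᵘ.≃ (+ n ℚᵘ./ 1)
  toℚᵘ-mult zero    = ℚᵘ.≃-refl
  toℚᵘ-mult (suc n) = ℚᵘ.≃-trans (toℚᵘ-homo-+ 1ℚ (mult n 1ℚ))
    (ℚᵘ.≃-trans (ℚᵘ.+-congʳ ℚᵘ.1ℚᵘ (toℚᵘ-mult n))
      (ℚᵘ.≃-reflexive (cong (ℚᵘ._/ 1) (cong (ℤ._+_ (+ 1)) (ℤ.*-identityʳ (+ n))))))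

  archimedean : ∀ p → ∃ λ n → p ≤ mult n 1ℚ
  archimedean p@(mkℚ i d _) = ℤ.∣ i ∣ , toℚᵘ-cancel-≤
    (ℚᵘ.≤-respʳ-≃ (ℚᵘ.≃-sym (toℚᵘ-mult ℤ.∣ i ∣)) (ℚᵘ.*≤* le))
    where
    i≤∣i∣ : ∀ i → i ℤ.≤ + ℤ.∣ i ∣
    i≤∣i∣ (+ n)    = ℤ.≤-refl
    i≤∣i∣ -[1+ n ] = ℤ.-≤+
    le : i ℤ.* + 1 ℤ.≤ + ℤ.∣ i ∣ ℤ.* + suc d
    le = ℤ.≤-trans (ℤ.≤-reflexive (ℤ.*-identityʳ i)) (ℤ.≤-trans (i≤∣i∣ i)
      (subst (λ z → + ℤ.∣ i ∣ ℤ.≤ z) (ℤ.pos-* ℤ.∣ i ∣ (suc d))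
        (ℤ.+≤+ (ℕ.m≤m*n ℤ.∣ i ∣ (suc d)))))

  -- Powers of σ > 1 are unbounded.
  pow-unbounded : ∀ {σ} → 1ℚ < σ → ∀ b → ∃ λ n → b < pow σ n
  pow-unbounded {σ} 1<σ b = n , <-≤-trans b<1+m (bernoulli 1<σ n)
    where
    δ = σ - 1ℚ
    0<δ : 0ℚ < δ
    0<δ = p<q⇒0<q-p 1<σ
    c = proj₁ (recip 0<δ)
    cδ = proj₂ (proj₂ (recip 0<δ))
    n = proj₁ (archimedean (b * c))
    b≤m : b ≤ mult n δ
    b≤m = subst₂ _≤_
      (trans (*-assoc b c δ) (trans (cong (b *_) cδ) (*-identityʳ b)))
      (trans (mult-distrib n 1ℚ δ) (cong (mult n) (*-identityˡ δ)))
      (*-monoʳ-≤-nonNeg δ {{nonNegative (<⇒≤ 0<δ)}} (proj₂ (archimedean (b * c))))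
    b<1+m : b < 1ℚ + mult n δ
    b<1+m = ≤-<-trans b≤m (subst (mult n δ <_) (+-comm (mult n δ) 1ℚ) (p<p+ 0<1))

  <-or-≥ : ∀ p q → p < q ⊎ q ≤ p
  <-or-≥ p q with p <? q
  ... | yes p<q = inj₁ p<q
  ... | no  p≮q = inj₂ (≮⇒≥ p≮q)

  cancel-inverse : ∀ c q p → c * p ≡ 1ℚ → c * q * p ≡ q
  cancel-inverse c q p cp =
    trans (solve 3 (λ c q p → c :* q :* p := (c :* p) :* q) refl c q p)
      (trans (cong (_* q) cp) (*-identityˡ q))

  factor : ∀ {p q} → 0ℚ < p → p < q → ∃ λ σ → 1ℚ < σ × σ * σ * p < q
  factor {p} {q} 0<p p<q =
    let (c , 0<c , cp) = recip 0<p
        (σ , 1<σ , σ²<t) = between-1-and-√ {c * q} (subst (_< c * q) cp (×-monoˡ 0<c p<q))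
    in σ , 1<σ , subst (σ * σ * p <_) (cancel-inverse c q p cp) (×-monoʳ 0<p σ²<t)

  ratio : ∀ {r s} → 0ℚ < r → r < s → ∃ λ σ → 1ℚ < σ × (σ * σ) * (σ * σ) * r < s
  ratio {r} {s} 0<r r<s =
    let (τ , 1<τ , τ²r<s) = factor 0<r r<s
        (σ , 1<σ , σ²<τ) = between-1-and-√ 1<τ
        0<σ = <-trans 0<1 1<σ
        0<σ² = ×-pos 0<σ 0<σ
    in σ , 1<σ , <-trans (×-monoʳ 0<r (sq-mono 0<σ² σ²<τ)) τ²r<s

  scale : ∀ {r s} σ a c → 0ℚ < σ → a * c ≤ r → (σ * σ) * (σ * σ) * r < s →
          σ * (σ * a) * (σ * (σ * c)) < s
  scale {r} {s} σ a c 0<σ ac≤r σ⁴r<s = subst (_< s)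
    (solve 3 (λ σ a c → (σ :* σ) :* (σ :* σ) :* (a :* c)
                        := σ :* (σ :* a) :* (σ :* (σ :* c))) refl σ a c)
    (≤-<-trans (*-monoˡ-≤-nonNeg ((σ * σ) * (σ * σ)) {{nonNegative (<⇒≤ 0<σ⁴)}} ac≤r) σ⁴r<s)
    where
    0<σ⁴ : 0ℚ < (σ * σ) * (σ * σ)
    0<σ⁴ = ×-pos (×-pos 0<σ 0<σ) (×-pos 0<σ 0<σ)

  *-cancel-< : ∀ p q r → 0ℚ < r → p * r < q * r → p < q
  *-cancel-< p q r 0<r = *-cancelʳ-<-nonNeg r {{nonNegative (<⇒≤ 0<r)}} {p} {q}

  -- For r < s, rationals c₂ < c₁ strictly between 1/s and 1/r.
  between-recip : ∀ {r s} → 0ℚ < r → r < s → ∃₂ λ c₁ c₂ →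
    0ℚ < c₂ × c₂ < c₁ × r * c₁ < 1ℚ × 1ℚ < s * c₂
  between-recip {r} {s} 0<r r<s =
    let (t₂ , r<t₂ , t₂<s) = <-dense r<s
        (t₁ , r<t₁ , t₁<t₂) = <-dense r<t₂
        0<t₂ = <-trans 0<r r<t₂
        (c₁ , 0<c₁ , e₁) = recip (<-trans 0<r r<t₁)
        (c₂ , 0<c₂ , e₂) = recip 0<t₂
    in c₁ , c₂ , 0<c₂
      , *-cancel-< c₂ c₁ t₂ 0<t₂ (subst (_< c₁ * t₂) (trans e₁ (sym e₂)) (×-monoˡ 0<c₁ t₁<t₂))
      , subst (r * c₁ <_) (trans (*-comm t₁ c₁) e₁) (×-monoʳ 0<c₁ r<t₁)
      , subst (_< s * c₂) (trans (*-comm t₂ c₂) e₂) (×-monoʳ 0<c₂ t₂<s)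

  r*b<1-open : ∀ r b → 0ℚ < b → r * b < 1ℚ → ∃ λ s → r < s × s * b < 1ℚ
  r*b<1-open r b 0<b rb<1 =
    let (c , 0<c , cb) = recip 0<b
        (s , r<s , s<c) = <-dense (*-cancel-< r c b 0<b (subst (r * b <_) (sym cb) rb<1))
    in s , r<s , subst (s * b <_) cb (×-monoʳ 0<b s<c)

  1<s*a-open : ∀ s a → 0ℚ < a → 1ℚ < s * a → ∃ λ r → r < s × 1ℚ < r * a
  1<s*a-open s a 0<a 1<sa =
    let (c , 0<c , ca) = recip 0<a
        (r , c<r , r<s) = <-dense (*-cancel-< c s a 0<a (subst (_< s * a) (sym ca) 1<sa))
    in r , r<s , subst (_< r * a) ca (×-monoʳ 0<a c<r)

  root-open-below : ∀ r {p} → 0ℚ < r → r * r < p → ∃ λ s → r < s × s * s < p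
  root-open-below r {p} 0<r r²<p =
    let (σ , 1<σ , σ²r²<p) = factor (×-pos 0<r 0<r) r²<p
    in σ * r
      , subst (_< σ * r) (*-identityˡ r) (×-monoʳ 0<r 1<σ)
      , subst (_< p) (solve 2 (λ s r → s :* s :* (r :* r) := (s :* r) :* (s :* r)) refl σ r) σ²r²<p

  scale-down : ∀ σ c p s → c * σ ≡ 1ℚ → 0ℚ < c → σ * σ * p < s * s → p < (c * s) * (c * s)
  scale-down σ c p s cσ 0<c lt = subst₂ _<_ eq₁ eq₂ (×-monoˡ (×-pos 0<c 0<c) lt)
    where
    eq₁ : c * c * (σ * σ * p) ≡ p
    eq₁ = trans (solve 3 (λ c σ p → c :* c :* (σ :* σ :* p) := (c :* σ) :* (c :* σ) :* p) refl c σ p)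
      (trans (cong (λ z → z * z * p) cσ) (*-identityˡ p))
    eq₂ : c * c * (s * s) ≡ (c * s) * (c * s)
    eq₂ = solve 2 (λ c s → c :* c :* (s :* s) := (c :* s) :* (c :* s)) refl c s

  root-open-above : ∀ s {p} → 0ℚ < s → 0ℚ < p → p < s * s →
                    ∃ λ r → 0ℚ < r × r < s × p < r * r
  root-open-above s {p} 0<s 0<p p<s² =
    let (σ , 1<σ , σ²p<s²) = factor 0<p p<s²
        (c , 0<c , cσ) = recip (<-trans 0<1 1<σ)
        c<1 = subst₂ _<_ (*-identityʳ c) cσ (×-monoˡ 0<c 1<σ)
    in c * s , ×-pos 0<c 0<s
      , subst (c * s <_) (*-identityˡ s) (×-monoʳ 0<s c<1)
      , scale-down σ c p s cσ 0<c σ²p<s²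

open ℚ-Lemmas

------------------------------------------------------------------------
-- Positive real numbers, as two-sided Dedekind cuts in the positive
-- rationals: L r means "0 < r < x" and U s means "x < s".  Real powers
-- q^(k/4) with k ∈ ℤ are expressed as (√ √ q) ^ k.

record ℝ⁺ : Set₁ where
  field
    L U         : ℚ → Set
    L-inhabited : ∃ L
    U-inhabited : ∃ U
    L-positive  : ∀ {r} → L r → 0ℚ < r
    L-down      : ∀ {r s} → 0ℚ < r → r < s → L s → L r
    L-open      : ∀ {r} → L r → ∃ λ s → r < s × L s
    U-up        : ∀ {r s} → r < s → U r → U s
    U-open      : ∀ {s} → U s → ∃ λ r → r < s × U r
    disjoint    : ∀ {r} → L r → ¬ U r
    located     : ∀ {r s} → 0ℚ < r → r < s → L r ⊎ U s

  L<U : ∀ {r s} → L r → U s → r < s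
  L<U {r} {s} Lr Us with <-cmp r s
  ... | tri< r<s _ _ = r<s
  ... | tri≈ _ refl _ = ⊥-elim (disjoint Lr Us)
  ... | tri> _ _ s<r = ⊥-elim (disjoint Lr (U-up s<r Us))

  U-positive : ∀ {s} → U s → 0ℚ < s
  U-positive Us = <-trans (L-positive (proj₂ L-inhabited)) (L<U (proj₂ L-inhabited) Us)

open ℝ⁺

-- Every positive rational below y is below x.
infix 4 _≥ᴿ_
_≥ᴿ_ : ℝ⁺ → ℝ⁺ → Set
x ≥ᴿ y = ∀ {r} → L y r → L x r

fromℚ : (x : ℚ) → 0ℚ < x → ℝ⁺
fromℚ x 0<x = record
  { L = λ r → 0ℚ < r × r < x
  ; U = λ s → x < s
  ; L-inhabited = let (r , 0<r , r<x) = <-dense 0<x in r , 0<r , r<x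
  ; U-inhabited = x + 1ℚ , p<p+ 0<1
  ; L-positive = proj₁
  ; L-down = λ 0<r r<s (_ , s<x) → 0<r , <-trans r<s s<x
  ; L-open = λ (0<r , r<x) → let (s , r<s , s<x) = <-dense r<x in
      s , r<s , <-trans 0<r r<s , s<x
  ; U-up = λ r<s x<r → <-trans x<r r<s
  ; U-open = λ x<s → let (r , x<r , r<s) = <-dense x<s in r , r<s , x<r
  ; disjoint = λ (_ , r<x) x<r → <-asym r<x x<r
  ; located = loc
  }
  where
  loc : ∀ {r s} → 0ℚ < r → r < s → (0ℚ < r × r < x) ⊎ x < s
  loc {r} 0<r r<s with r <? x
  ... | yes r<x = inj₁ (0<r , r<x)
  ... | no  r≮x = inj₂ (≤-<-trans (≮⇒≥ r≮x) r<s)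

private

  -- Rational bounds of a positive real within any given ratio σ² > 1.
  squeeze : ∀ x {σ} → 1ℚ < σ → ∃ λ a → L x a × U x (σ * (σ * a))
  squeeze x {σ} 1<σ = walk n (proj₂ (L-inhabited x)) start
    where
    0<σ = <-trans 0<1 1<σ
    a₀ = proj₁ (L-inhabited x)
    0<a₀ = L-positive x (proj₂ (L-inhabited x))
    b₀ = proj₁ (U-inhabited x)
    c = proj₁ (recip 0<a₀)
    n = proj₁ (pow-unbounded 1<σ (b₀ * c))
    start : U x (pow σ n * a₀)
    start = U-up x (subst (_< pow σ n * a₀)
      (trans (*-assoc b₀ c a₀) (trans (cong (b₀ *_) (proj₂ (proj₂ (recip 0<a₀)))) (*-identityʳ b₀)))
      (×-monoʳ 0<a₀ (proj₂ (pow-unbounded 1<σ (b₀ * c))))) (proj₂ (U-inhabited x))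
    grow : ∀ {a} → 0ℚ < a → a < σ * a
    grow {a} 0<a = subst (_< σ * a) (*-identityˡ a) (×-monoʳ 0<a 1<σ)
    walk : ∀ n {a} → L x a → U x (pow σ n * a) → ∃ λ a → L x a × U x (σ * (σ * a))
    walk zero    {a} La Ua = ⊥-elim (disjoint x La (subst (U x) (*-identityˡ a) Ua))
    walk (suc n) {a} La Ua
      with located x (×-pos 0<σ (L-positive x La)) (grow (×-pos 0<σ (L-positive x La)))
    ... | inj₂ Uσσa = a , La , Uσσa
    ... | inj₁ Lσa  = walk n Lσa (subst (U x)
      (solve 3 (λ s p a → s :* p :* a := p :* (s :* a)) refl σ (pow σ n) a) Ua)

infixl 7 _·_ _÷_
infixr 8 _^_
infix  9 √_

_·_ : ℝ⁺ → ℝ⁺ → ℝ⁺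
x · y = record
  { L = L·
  ; U = U·
  ; L-inhabited =
      let (a , La) = L-inhabited x
          (c , Lc) = L-inhabited y
          (r , 0<r , r<ac) = <-dense (×-pos (L-positive x La) (L-positive y Lc))
      in r , 0<r , a , c , La , Lc , r<ac
  ; U-inhabited =
      let (b , Ub) = U-inhabited x
          (d , Ud) = U-inhabited y
      in b * d + 1ℚ , b , d , Ub , Ud , p<p+ 0<1
  ; L-positive = proj₁
  ; L-down = λ 0<r r<s (_ , a , c , La , Lc , s<ac) →
      0<r , a , c , La , Lc , <-trans r<s s<ac
  ; L-open = λ (0<r , a , c , La , Lc , r<ac) →
      let (s , r<s , s<ac) = <-dense r<ac
      in s , r<s , <-trans 0<r r<s , a , c , La , Lc , s<ac
  ; U-up = λ r<s (b , d , Ub , Ud , bd<r) → b , d , Ub , Ud , <-trans bd<r r<s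
  ; U-open = λ (b , d , Ub , Ud , bd<s) →
      let (r , bd<r , r<s) = <-dense bd<s
      in r , r<s , b , d , Ub , Ud , bd<r
  ; disjoint = λ (_ , a , c , La , Lc , r<ac) (b , d , Ub , Ud , bd<r) →
      <-asym (<-trans bd<r r<ac)
        (×-mono (L-positive x La) (U-positive y Ud) (L<U x La Ub) (L<U y Lc Ud))
  ; located = loc
  }
  where
  L· U· : ℚ → Set
  L· r = 0ℚ < r × ∃₂ λ a c → L x a × L y c × r < a * c
  U· s = ∃₂ λ b d → U x b × U y d × b * d < s
  loc : ∀ {r s} → 0ℚ < r → r < s → L· r ⊎ U· s
  loc {r} {s} 0<r r<s =
    let (σ , 1<σ , σ⁴r<s) = ratio 0<r r<s
        (a , La , Ub) = squeeze x 1<σ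
        (c , Lc , Ud) = squeeze y 1<σ
    in [ (λ r<ac → inj₁ (0<r , a , c , La , Lc , r<ac))
       , (λ ac≤r → inj₂ (σ * (σ * a) , σ * (σ * c) , Ub , Ud ,
                         scale σ a c (<-trans 0<1 1<σ) ac≤r σ⁴r<s))
       ]′ (<-or-≥ r (a * c))

_⁻¹ : ℝ⁺ → ℝ⁺
x ⁻¹ = record
  { L = L⁻
  ; U = U⁻
  ; L-inhabited =
      let (b , Ub) = U-inhabited x
          (c , 0<c , cb) = recip (U-positive x Ub)
          (r , 0<r , r<c) = <-dense 0<c
      in r , 0<r , b , Ub , subst (r * b <_) cb (×-monoʳ (U-positive x Ub) r<c)
  ; U-inhabited =
      let (a , La) = L-inhabited x
          (c , 0<c , ca) = recip (L-positive x La)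
      in c + 1ℚ , a , La , subst (_< (c + 1ℚ) * a) ca (×-monoʳ (L-positive x La) (p<p+ {c} 0<1))
  ; L-positive = proj₁
  ; L-down = λ 0<r r<s (_ , b , Ub , sb<1) →
      0<r , b , Ub , <-trans (×-monoʳ (U-positive x Ub) r<s) sb<1
  ; L-open = λ (0<r , b , Ub , rb<1) →
      let (s , r<s , sb<1) = r*b<1-open _ b (U-positive x Ub) rb<1
      in s , r<s , <-trans 0<r r<s , b , Ub , sb<1
  ; U-up = λ r<s (a , La , 1<ra) → a , La , <-trans 1<ra (×-monoʳ (L-positive x La) r<s)
  ; U-open = λ (a , La , 1<sa) →
      let (r , r<s , 1<ra) = 1<s*a-open _ a (L-positive x La) 1<sa
      in r , r<s , a , La , 1<ra
  ; disjoint = λ (0<r , b , Ub , rb<1) (a , La , 1<ra) →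
      <-asym (<-trans rb<1 1<ra) (×-monoˡ 0<r (L<U x La Ub))
  ; located = loc
  }
  where
  L⁻ U⁻ : ℚ → Set
  L⁻ r = 0ℚ < r × ∃ λ b → U x b × r * b < 1ℚ
  U⁻ s = ∃ λ a → L x a × 1ℚ < s * a
  loc : ∀ {r s} → 0ℚ < r → r < s → L⁻ r ⊎ U⁻ s
  loc 0<r r<s =
    let (c₁ , c₂ , 0<c₂ , c₂<c₁ , rc₁<1 , 1<sc₂) = between-recip 0<r r<s
    in [ (λ Lc₂ → inj₂ (c₂ , Lc₂ , 1<sc₂))
       , (λ Uc₁ → inj₁ (0<r , c₁ , Uc₁ , rc₁<1))
       ]′ (located x 0<c₂ c₂<c₁)

_÷_ : ℝ⁺ → ℝ⁺ → ℝ⁺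
x ÷ y = x · y ⁻¹

√_ : ℝ⁺ → ℝ⁺
√ x = record
  { L = L√
  ; U = U√
  ; L-inhabited = inh
  ; U-inhabited =
      let (b , Ub) = U-inhabited x
          0<b = U-positive x Ub
          s = b + 1ℚ
          0<s = <-trans 0<b (p<p+ 0<1)
          1<s = subst (1ℚ <_) (+-comm 1ℚ b) (p<p+ 0<b)
      in s , 0<s , U-up x (<-trans (p<p+ 0<1) (subst (_< s * s) (*-identityʳ s) (×-monoˡ 0<s 1<s))) Ub
  ; L-positive = proj₁
  ; L-down = λ 0<r r<s (_ , Ls²) → 0<r , L-down x (×-pos 0<r 0<r) (sq-mono 0<r r<s) Ls²
  ; L-open = lopen
  ; U-up = λ r<s (0<r , Ur²) → <-trans 0<r r<s , U-up x (sq-mono 0<r r<s) Ur²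
  ; U-open = uopen
  ; disjoint = λ (_ , Lr²) (_ , Ur²) → disjoint x Lr² Ur²
  ; located = λ 0<r r<s →
      [ (λ Lr² → inj₁ (0<r , Lr²)) , (λ Us² → inj₂ (<-trans 0<r r<s , Us²)) ]′
        (located x (×-pos 0<r 0<r) (sq-mono 0<r r<s))
  }
  where
  L√ U√ : ℚ → Set
  L√ r = 0ℚ < r × L x (r * r)
  U√ s = 0ℚ < s × U x (s * s)

  inh : ∃ L√
  inh with L-inhabited x
  ... | a , La with <-cmp a 1ℚ
  ...   | tri< a<1 _ _ = a , 0<a , L-down x (×-pos 0<a 0<a)
            (subst (a * a <_) (*-identityʳ a) (×-monoˡ 0<a a<1)) La
    where 0<a = L-positive x La
  ...   | tri≈ _ refl _ = 1ℚ , 0<1 , La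
  ...   | tri> _ _ 1<a = 1ℚ , 0<1 , L-down x 0<1 1<a La

  lopen : ∀ {r} → L√ r → ∃ λ s → r < s × L√ s
  lopen {r} (0<r , Lr²) =
    let (p , r²<p , Lp) = L-open x Lr²
        (s , r<s , s²<p) = root-open-below r 0<r r²<p
        0<s = <-trans 0<r r<s
    in s , r<s , 0<s , L-down x (×-pos 0<s 0<s) s²<p Lp

  uopen : ∀ {s} → U√ s → ∃ λ r → r < s × U√ r
  uopen {s} (0<s , Us²) =
    let (p , p<s² , Up) = U-open x Us²
        (r , 0<r , r<s , p<r²) = root-open-above s 0<s (U-positive x Up) p<s²
    in r , r<s , 0<r , U-up x p<r² Up

_^ⁿ_ : ℝ⁺ → ℕ → ℝ⁺
x ^ⁿ zero  = fromℚ 1ℚ 0<1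
x ^ⁿ suc n = x · x ^ⁿ n

_^_ : ℝ⁺ → ℤ → ℝ⁺
x ^ (+ n)    = x ^ⁿ n
x ^ -[1+ n ] = (x ^ⁿ suc n) ⁻¹

0</ : ∀ {i} d .{{_ : ℕ.NonZero d}} → ℤ.0ℤ ℤ.< i → 0ℚ < i / d
0</ {+ suc n} d _ = positive⁻¹ (+ suc n / d) {{normalize-pos (suc n) d}}
0</ {+ zero}  d (ℤ.+<+ ())

fromℤ : (i : ℤ) → ℤ.0ℤ ℤ.< i → ℝ⁺
fromℤ i 0<i = fromℚ (i / 1) (0</ 1 0<i)

------------------------------------------------------------------------

v : (q a b : ℤ) → ℕ → ℤ
v q a b n = a ℤ.* q ℤ.^ n ℤ.+ b

-- lcm {u 1, …, u n}: the term u 0 is excluded.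
lcmUpTo : (ℕ → ℤ) → ℕ → ℤ
lcmUpTo u zero    = + 1
lcmUpTo u (suc n) = lcm (lcmUpTo u n) (u (suc n))

B′ : (q a b : ℤ) → ℚ
B′ q a b = (a ℤ.* (q ℤ.- + 1)) / 1 ⊔ (b ℤ.* (q ℤ.- + 1) ℤ.+ + 1) / 2

-- The positivity facts needed to view the quantities involved as
-- elements of ℝ⁺.
module Positivity (q a b : ℤ) (2≤q : + 2 ℤ.≤ q) (1≤a : + 1 ℤ.≤ a) (-a≤b : ℤ.- a ℤ.≤ b) where

  private
    *-pos : ∀ {i j} → ℤ.0ℤ ℤ.< i → ℤ.0ℤ ℤ.< j → ℤ.0ℤ ℤ.< i ℤ.* j
    *-pos {+ suc m} {+ suc n} _ _ = ℤ.+<+ (ℕ.s≤s ℕ.z≤n)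
    *-pos {+ zero} (ℤ.+<+ ()) _
    *-pos {+ suc m} {+ zero} _ (ℤ.+<+ ())

    0<1ᶻ : ℤ.0ℤ ℤ.< + 1
    0<1ᶻ = ℤ.+<+ (ℕ.s≤s ℕ.z≤n)

    0<a : ℤ.0ℤ ℤ.< a
    0<a = ℤ.<-≤-trans 0<1ᶻ 1≤a

    0<q-1 : ℤ.0ℤ ℤ.< q ℤ.- + 1
    0<q-1 = ℤ.<-≤-trans 0<1ᶻ (ℤ.+-monoˡ-≤ (ℤ.- + 1) 2≤q)

    0<a[q-1] : ℤ.0ℤ ℤ.< a ℤ.* (q ℤ.- + 1)
    0<a[q-1] = *-pos 0<a 0<q-1

  0<q : ℤ.0ℤ ℤ.< q
  0<q = ℤ.<-≤-trans (ℤ.+<+ (ℕ.s≤s ℕ.z≤n)) 2≤q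

  0<a[q-1]+1 : ℤ.0ℤ ℤ.< a ℤ.* (q ℤ.- + 1) ℤ.+ + 1
  0<a[q-1]+1 = ℤ.+-mono-< 0<a[q-1] 0<1ᶻ

  0<B′ : 0ℚ < B′ q a b
  0<B′ = <-≤-trans (0</ 1 0<a[q-1]) (p≤p⊔q _ _)

  private
    q^n-positive : ∀ n → ℤ.0ℤ ℤ.< q ℤ.^ n
    q^n-positive zero    = 0<1ᶻ
    q^n-positive (suc n) = *-pos 0<q (q^n-positive n)

    a<ac : ∀ {c} → + 2 ℤ.≤ c → a ℤ.< a ℤ.* c
    a<ac {c} 2≤c = subst (ℤ._< a ℤ.* c) (ℤ.*-identityʳ a)
      (ℤ.*-monoˡ-<-pos a {{ℤ.positive 0<a}} (ℤ.<-≤-trans (ℤ.+<+ (ℕ.s≤s (ℕ.s≤s ℕ.z≤n))) 2≤c))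

    0<ac+b : ∀ {c} → + 2 ℤ.≤ c → ℤ.0ℤ ℤ.< a ℤ.* c ℤ.+ b
    0<ac+b {c} 2≤c = subst (ℤ._< a ℤ.* c ℤ.+ b) (ℤ.+-inverseʳ a) (ℤ.+-mono-<-≤ (a<ac 2≤c) -a≤b)

    2≤q^1+n : ∀ n → + 2 ℤ.≤ q ℤ.^ suc n
    2≤q^1+n n = ℤ.≤-trans 2≤q (subst (ℤ._≤ q ℤ.* q ℤ.^ n) (ℤ.*-identityʳ q)
      (ℤ.*-monoˡ-≤-nonNeg q {{ℤ.nonNegative (ℤ.<⇒≤ 0<q)}} (ℤ.i<j⇒suc[i]≤j (q^n-positive n))))

    lcm-pos : ∀ {i j} → ℤ.0ℤ ℤ.< i → ℤ.0ℤ ℤ.< j → ℤ.0ℤ ℤ.< lcm i j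
    lcm-pos {+ suc m} {+ suc n} _ _ = ℤ.+<+ (ℕ.n≢0⇒n>0 λ eq →
      absurd (trans (sym (ℕL.gcd*lcm (suc m) (suc n)))
        (trans (cong (ℕG.gcd (suc m) (suc n) ℕ.*_) eq) (ℕ.*-zeroʳ (ℕG.gcd (suc m) (suc n))))))
      where
      absurd : ¬ (suc m ℕ.* suc n ≡ 0)
      absurd ()
    lcm-pos {+ zero} (ℤ.+<+ ()) _
    lcm-pos {+ suc m} {+ zero} _ (ℤ.+<+ ())

  0<aq+b : ℤ.0ℤ ℤ.< a ℤ.* q ℤ.+ b
  0<aq+b = 0<ac+b 2≤q

  0<lcm : ∀ n → ℤ.0ℤ ℤ.< lcmUpTo (v q a b) n
  0<lcm zero    = 0<1ᶻ
  0<lcm (suc n) = lcm-pos (0<lcm n) (0<ac+b (2≤q^1+n n))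

0<2 : ℤ.0ℤ ℤ.< + 2
0<2 = ℤ.+<+ (ℕ.s≤s ℕ.z≤n)

{-# OPTIONS --safe #-}
module Submission where

open import Defs
open import Data.Integer using (ℤ; +_; _+_; _-_; _*_; -_; _≤_)
open import Data.Integer.GCD using (gcd)
open import Data.Nat as ℕ using (ℕ)
open import Relation.Binary.PropositionalEquality using (_≡_)

open import Data.Empty using (⊥-elim)
open import Data.Integer as ℤ using (-[1+_]; +≤+; +<+)
import Data.Integer.Divisibility.Signed as ℤ
import Data.Integer.Properties as ℤ
open import Data.Integer.Tactic.RingSolver using () renaming (solve-∀ to solveℤ-∀)
open import Data.Nat using (zero; suc)
open import Data.Nat.Coprimality as Coprime using (Coprime; coprime-divisor)
import Data.Nat.Divisibility as ℕ
import Data.Nat.GCD as ℕ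
import Data.Nat.LCM as ℕ
import Data.Nat.Properties as ℕ
open import Data.Nat.Tactic.RingSolver using (solve-∀)
open import Data.Product.Base using (_×_; _,_; ∃; ∃₂)
open import Data.Rational.Base as ℚ using (ℚ; 0ℚ; 1ℚ)
import Data.Rational.Properties as ℚ
open import Data.Rational.Solver using (module +-*-Solver)
import Data.Rational.Unnormalised.Base as ℚᵘ
import Data.Rational.Unnormalised.Properties as ℚᵘ
open import Data.Sum.Base using (_⊎_; inj₁; inj₂; [_,_]′)
open import Function.Base using (id; it)
open import Relation.Binary.PropositionalEquality
  using (refl; sym; trans; cong; cong₂; subst; subst₂; module ≡-Reasoning)
open ℚ-Lemmas
open ℝ⁺

-- Any common multiple l of v_k, …, v_n satisfies v_k ⋯ v_n ∣ l (q - 1) ⋯ (q^(n-k) - 1): the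
-- differences v_j - v_i = a q^i (q^(j-i) - 1) allow an induction on n - k, in which a q is
-- cancelled because it is coprime to all v_i.  As v_i ≥ a (q^i - 1) and v_n ≥ v_1, this gives
-- l ≥ v_1 (a q^(k-1))^(n-k).  With n - k about (n - 1) / 2 this exceeds the claimed bound, in which
-- (a (q - 1) + 1) / (2 √B′) may be replaced by √(a q).  The roots disappear in fourth powers.

-- Coprimality of products and powers.

coprime-* : ∀ {m n k} → Coprime m k → Coprime n k → Coprime (m ℕ.* n) k
-- As d divides k, it is coprime to m; dividing m n, it then divides n.
coprime-* {m} {n} m⊥k n⊥k {d} (d∣mn , d∣k) =
  n⊥k (coprime-divisor (λ (e∣d , e∣m) → m⊥k (e∣m , ℕ.∣-trans e∣d d∣k)) d∣mn , d∣k)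

coprime-^ : ∀ {m k} → Coprime m k → ∀ n → Coprime m (k ℕ.^ n)
coprime-^ m⊥k zero    = λ (_ , d∣1) → ℕ.∣1⇒≡1 d∣1
coprime-^ m⊥k (suc n) = Coprime.sym (coprime-* (Coprime.sym m⊥k) (Coprime.sym (coprime-^ m⊥k n)))

-- Products of consecutive terms and their common multiples.

module QSequence (q a s : ℕ) .{{_ : ℕ.NonZero q}} where

  gap : ℕ → ℕ
  gap n = ℕ.pred (q ℕ.^ n)

  suc-gap : ∀ n → q ℕ.^ n ≡ suc (gap n)
  suc-gap n = sym (ℕ.suc-pred (q ℕ.^ n) {{ℕ.m^n≢0 q n}})

  -- u n = v (n + 1) when s = a + b.
  u : ℕ → ℕ
  u n = a ℕ.* gap (suc n) ℕ.+ s

  ∏u : ℕ → ℕ → ℕ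
  ∏u i zero    = 1
  ∏u i (suc m) = ∏u i m ℕ.* u (i ℕ.+ m)

  -- Up to sign the q-Pochhammer symbol (q; q)_m, that is, (q - 1)^m times the q-factorial of m.
  ∏gap : ℕ → ℕ
  ∏gap zero    = 1
  ∏gap (suc m) = gap (suc m) ℕ.* ∏gap m

  gap-+ : ∀ m n → gap (m ℕ.+ n) ≡ gap m ℕ.+ q ℕ.^ m ℕ.* gap n
  gap-+ m n = ℕ.suc-injective (begin
    suc (gap (m ℕ.+ n))                 ≡⟨ suc-gap (m ℕ.+ n) ⟨
    q ℕ.^ (m ℕ.+ n)                     ≡⟨ ℕ.^-distribˡ-+-* q m n ⟩
    q ℕ.^ m ℕ.* q ℕ.^ n                 ≡⟨ cong (q ℕ.^ m ℕ.*_) (suc-gap n) ⟩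
    q ℕ.^ m ℕ.* suc (gap n)             ≡⟨ ℕ.*-suc (q ℕ.^ m) (gap n) ⟩
    q ℕ.^ m ℕ.+ q ℕ.^ m ℕ.* gap n       ≡⟨ cong (ℕ._+ q ℕ.^ m ℕ.* gap n) (suc-gap m) ⟩
    suc (gap m ℕ.+ q ℕ.^ m ℕ.* gap n)   ∎)
    where open ≡-Reasoning

  u-+ : ∀ i n → u (i ℕ.+ n) ≡ u i ℕ.+ a ℕ.* q ℕ.^ suc i ℕ.* gap n
  u-+ i n = trans (cong (λ g → a ℕ.* g ℕ.+ s) (gap-+ (suc i) n))
    (lemma a (gap (suc i)) (q ℕ.^ suc i) (gap n) s)
    where
    lemma : ∀ a g p h s → a ℕ.* (g ℕ.+ p ℕ.* h) ℕ.+ s ≡ a ℕ.* g ℕ.+ s ℕ.+ a ℕ.* p ℕ.* h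
    lemma = solve-∀

  -- `∏u` grows at its end, while the induction in `∏u-∣` also has to split off the first factor.
  ∏u-cons : ∀ i m → ∏u i (suc m) ≡ u i ℕ.* ∏u (suc i) m
  ∏u-cons i zero    = trans (ℕ.*-comm 1 (u (i ℕ.+ 0))) (cong (λ j → u j ℕ.* 1) (ℕ.+-identityʳ i))
  ∏u-cons i (suc m) = trans
    (cong₂ ℕ._*_ (∏u-cons i m) (cong u (ℕ.+-suc i m)))
    (ℕ.*-assoc (u i) (∏u (suc i) m) _)

  ∏u-coprime : ∀ {k} → (∀ n → Coprime (u n) k) → ∀ i m → Coprime (∏u i m) k
  ∏u-coprime u⊥k i zero    = λ (d∣1 , _) → ℕ.∣1⇒≡1 d∣1
  ∏u-coprime u⊥k i (suc m) = coprime-* (∏u-coprime u⊥k i m) (u⊥k (i ℕ.+ m))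

  -- The product W = u i ⋯ u (i + m + 1) divides both u (i + m + 1) · M and u i · M
  -- for M = l · ∏gap m, hence also their difference, a q^(i+1) · gap (m + 1) · M,
  -- in which the factor a q^(i+1) is coprime to W.
  ∏u-∣ : (∀ n → Coprime (u n) (a ℕ.* q)) →
         ∀ {l} i m → (∀ j → j ℕ.≤ m → u (i ℕ.+ j) ℕ.∣ l) → ∏u i (suc m) ℕ.∣ l ℕ.* ∏gap m
  ∏u-∣ u⊥aq {l} i zero    u∣l = subst₂ ℕ._∣_ (sym (ℕ.+-identityʳ _)) (sym (ℕ.*-identityʳ l)) (u∣l 0 ℕ.z≤n)
  ∏u-∣ u⊥aq {l} i (suc m) u∣l =
    subst (W ℕ.∣_) (rearrange (gap (suc m)) l (∏gap m)) (coprime-divisor W⊥aqⁱ W∣diff)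
    where
    W M : ℕ
    W = ∏u i (suc (suc m))
    M = l ℕ.* ∏gap m
    rearrange : ∀ g l d → g ℕ.* (l ℕ.* d) ≡ l ℕ.* (g ℕ.* d)
    rearrange = solve-∀
    initial : ∏u i (suc m) ℕ.∣ M
    initial = ∏u-∣ u⊥aq i m (λ j j≤m → u∣l j (ℕ.m≤n⇒m≤1+n j≤m))
    final : ∏u (suc i) (suc m) ℕ.∣ M
    final = ∏u-∣ u⊥aq (suc i) m (λ j j≤m → subst (λ k → u k ℕ.∣ l) (ℕ.+-suc i j) (u∣l (suc j) (ℕ.s≤s j≤m)))
    W∣last : W ℕ.∣ u (i ℕ.+ suc m) ℕ.* M
    W∣last = subst (W ℕ.∣_) (ℕ.*-comm M _) (ℕ.*-monoˡ-∣ (u (i ℕ.+ suc m)) initial)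
    W∣first : W ℕ.∣ u i ℕ.* M
    W∣first = subst (ℕ._∣ u i ℕ.* M) (sym (∏u-cons i (suc m))) (ℕ.*-monoʳ-∣ (u i) final)
    split : ∀ x c g M → (x ℕ.+ c ℕ.* g) ℕ.* M ≡ x ℕ.* M ℕ.+ c ℕ.* (g ℕ.* M)
    split = solve-∀
    W∣diff : W ℕ.∣ a ℕ.* q ℕ.^ suc i ℕ.* (gap (suc m) ℕ.* M)
    W∣diff = ℕ.∣m+n∣m⇒∣n (subst (W ℕ.∣_)
      (trans (cong (ℕ._* M) (u-+ i (suc m))) (split (u i) (a ℕ.* q ℕ.^ suc i) (gap (suc m)) M)) W∣last) W∣first
    W⊥aq : Coprime W (a ℕ.* q)
    W⊥aq = ∏u-coprime u⊥aq i (suc (suc m))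
    W⊥aqⁱ : Coprime W (a ℕ.* q ℕ.^ suc i)
    W⊥aqⁱ = Coprime.sym (coprime-* {a} {q ℕ.^ suc i}
      (λ (d∣a , d∣W) → W⊥aq (d∣W , ℕ.∣m⇒∣m*n q d∣a))
      (Coprime.sym (coprime-^ {k = q} (λ (d∣W , d∣q) → W⊥aq (d∣W , ℕ.∣n⇒∣m*n a d∣q)) (suc i))))

  -- Factor by factor: dropping s and the summand `gap i` of `gap (i + (m + 1))` leaves u (i + m) ≥
  -- a q^i `gap (m + 1)`. The factors `gap` are kept because they cancel against those in `∏u-∣`.
  ∏u-≥ : ∀ i m → (a ℕ.* q ℕ.^ i) ℕ.^ m ℕ.* ∏gap m ℕ.≤ ∏u i m
  ∏u-≥ i zero    = ℕ.≤-refl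
  ∏u-≥ i (suc m) = begin
    c ℕ.* c ℕ.^ m ℕ.* (gap (suc m) ℕ.* ∏gap m)    ≡⟨ rearrange a (q ℕ.^ i) (c ℕ.^ m) (gap (suc m)) (∏gap m) ⟩
    c ℕ.^ m ℕ.* ∏gap m ℕ.* (a ℕ.* (q ℕ.^ i ℕ.* gap (suc m)))
      ≤⟨ ℕ.*-mono-≤ (∏u-≥ i m) (ℕ.*-monoʳ-≤ a (ℕ.m≤n+m _ (gap i))) ⟩
    ∏u i m ℕ.* (a ℕ.* (gap i ℕ.+ q ℕ.^ i ℕ.* gap (suc m)))
      ≡⟨ cong (λ g → ∏u i m ℕ.* (a ℕ.* g)) (trans (sym (gap-+ i (suc m))) (cong gap (ℕ.+-suc i m))) ⟩
    ∏u i m ℕ.* (a ℕ.* gap (suc (i ℕ.+ m)))        ≤⟨ ℕ.*-monoʳ-≤ (∏u i m) (ℕ.m≤m+n _ s) ⟩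
    ∏u i m ℕ.* u (i ℕ.+ m)                        ∎
    where
    open ℕ.≤-Reasoning
    c = a ℕ.* q ℕ.^ i
    rearrange : ∀ a p e g d → a ℕ.* p ℕ.* e ℕ.* (g ℕ.* d) ≡ e ℕ.* d ℕ.* (a ℕ.* (p ℕ.* g))
    rearrange = solve-∀

  ∏gap-nonZero : 2 ℕ.≤ q → ∀ m → ℕ.NonZero (∏gap m)
  ∏gap-nonZero 2≤q zero    = _
  ∏gap-nonZero 2≤q (suc m) = ℕ.m*n≢0 (gap (suc m)) (∏gap m) {{gap≢0}} {{∏gap-nonZero 2≤q m}}
    where
    gap≢0 : ℕ.NonZero (gap (suc m))
    gap≢0 = ℕ.>-nonZero (ℕ.s≤s⁻¹ (subst (2 ℕ.≤_) (suc-gap (suc m))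
      (ℕ.*-mono-≤ 2≤q (ℕ.m^n>0 q m))))

  -- By `∏u-∣` the product of the m + 1 terms from `u i` on is at most l · `∏gap m`. Its first m
  -- factors are bounded below by `∏u-≥` and the last one by `u 0`; then `∏gap m` cancels.
  common-multiple-≥ : 2 ℕ.≤ q → (∀ n → Coprime (u n) (a ℕ.* q)) →
    ∀ {l} .{{_ : ℕ.NonZero l}} i m → (∀ j → j ℕ.≤ i ℕ.+ m → u j ℕ.∣ l) →
    u 0 ℕ.* (a ℕ.* q ℕ.^ i) ℕ.^ m ℕ.≤ l
  common-multiple-≥ 2≤q u⊥aq {l} i m u∣l =
    ℕ.*-cancelʳ-≤ _ l D {{D≢0}} (begin
      u 0 ℕ.* c ℕ.^ m ℕ.* D         ≡⟨ rearrange (u 0) (c ℕ.^ m) D ⟩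
      c ℕ.^ m ℕ.* D ℕ.* u 0         ≤⟨ ℕ.*-mono-≤ (∏u-≥ i m) u0≤ ⟩
      ∏u i (suc m)                  ≤⟨ ℕ.∣⇒≤ {{ℕ.m*n≢0 l D {{it}} {{D≢0}}}}
                                         (∏u-∣ u⊥aq i m (λ j j≤m → u∣l (i ℕ.+ j) (ℕ.+-monoʳ-≤ i j≤m))) ⟩
      l ℕ.* D                       ∎)
    where
    open ℕ.≤-Reasoning
    c = a ℕ.* q ℕ.^ i
    D = ∏gap m
    D≢0 = ∏gap-nonZero 2≤q m
    rearrange : ∀ x e d → x ℕ.* e ℕ.* d ≡ e ℕ.* d ℕ.* x
    rearrange = solve-∀
    u0≤ : u 0 ℕ.≤ u (i ℕ.+ m)
    u0≤ = subst (u 0 ℕ.≤_) (sym (u-+ 0 (i ℕ.+ m))) (ℕ.m≤m+n (u 0) _)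

-- Powers of rational numbers.

*-mono-≤-nonNeg : ∀ {p q r s} → 0ℚ ℚ.≤ p → 0ℚ ℚ.≤ s → p ℚ.≤ q → r ℚ.≤ s → p ℚ.* r ℚ.≤ q ℚ.* s
*-mono-≤-nonNeg {p} {s = s} 0≤p 0≤s p≤q r≤s = ℚ.≤-trans
  (ℚ.*-monoˡ-≤-nonNeg p {{ℚ.nonNegative 0≤p}} r≤s)
  (ℚ.*-monoʳ-≤-nonNeg s {{ℚ.nonNegative 0≤s}} p≤q)

pow-pos : ∀ {p} n → 0ℚ ℚ.< p → 0ℚ ℚ.< pow p n
pow-pos zero    0<p = 0<1
pow-pos (suc n) 0<p = ×-pos 0<p (pow-pos n 0<p)

pow-+ : ∀ p m n → pow p (m ℕ.+ n) ≡ pow p m ℚ.* pow p n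
pow-+ p zero    n = sym (ℚ.*-identityˡ _)
pow-+ p (suc m) n = trans (cong (p ℚ.*_) (pow-+ p m n)) (sym (ℚ.*-assoc p _ _))

pow-* : ∀ p q n → pow (p ℚ.* q) n ≡ pow p n ℚ.* pow q n
pow-* p q zero    = refl
pow-* p q (suc n) = trans (cong (p ℚ.* q ℚ.*_) (pow-* p q n))
  (solve 4 (λ p q x y → p :* q :* (x :* y) := p :* x :* (q :* y)) refl p q (pow p n) (pow q n))
  where open +-*-Solver

pow-1 : ∀ n → pow 1ℚ n ≡ 1ℚ
pow-1 zero    = refl
pow-1 (suc n) = trans (ℚ.*-identityˡ _) (pow-1 n)

pow-mono-≤ : ∀ {p q} n → 0ℚ ℚ.< p → p ℚ.≤ q → pow p n ℚ.≤ pow q n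
pow-mono-≤ zero    0<p p≤q = ℚ.≤-refl
pow-mono-≤ (suc n) 0<p p≤q = *-mono-≤-nonNeg (ℚ.<⇒≤ 0<p)
  (ℚ.<⇒≤ (pow-pos n (ℚ.<-≤-trans 0<p p≤q))) p≤q (pow-mono-≤ n 0<p p≤q)

pow-mono-< : ∀ {p q} n .{{_ : ℕ.NonZero n}} → 0ℚ ℚ.< p → p ℚ.< q → pow p n ℚ.< pow q n
pow-mono-< {p} {q} (suc n) 0<p p<q = ℚ.<-≤-trans
  (×-monoʳ (pow-pos n 0<p) p<q)
  (ℚ.*-monoˡ-≤-nonNeg q {{ℚ.nonNegative (ℚ.<⇒≤ (ℚ.<-trans 0<p p<q))}}
    (pow-mono-≤ n 0<p (ℚ.<⇒≤ p<q)))

pow-cancel-< : ∀ {p q} n → 0ℚ ℚ.< q → pow p n ℚ.< pow q n → p ℚ.< q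
pow-cancel-< {p} {q} n 0<q pⁿ<qⁿ =
  [ id
  , (λ q≤p → ⊥-elim (ℚ.<-irrefl refl (ℚ.<-≤-trans pⁿ<qⁿ (pow-mono-≤ n 0<q q≤p))))
  ]′ (<-or-≥ p q)

-- Positive reals with a rational power.

-- Expresses x^k = p through the rational bounds of x, so that roots never have to be evaluated. The
-- inequalities are strict because cuts are open, and both sides are recorded because inversion
-- exchanges them.
record HasPower (k : ℕ) (x : ℝ⁺) (p : ℚ) : Set where
  field
    below : ∀ {r} → L x r → pow r k ℚ.< p
    above : ∀ {s} → U x s → p ℚ.< pow s k

  positive : 0ℚ ℚ.< p
  positive = let (r , Lr) = L-inhabited x in ℚ.<-trans (pow-pos k (L-positive x Lr)) (below Lr)

open HasPower

module _ {k : ℕ} .{{_ : ℕ.NonZero k}} where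

  fromℚ-power : ∀ {x} (0<x : 0ℚ ℚ.< x) → HasPower k (fromℚ x 0<x) (pow x k)
  fromℚ-power 0<x .below (0<r , r<x) = pow-mono-< k 0<r r<x
  fromℚ-power 0<x .above x<s         = pow-mono-< k 0<x x<s

  ·-power : ∀ {x y p p′} → HasPower k x p → HasPower k y p′ → HasPower k (x · y) (p ℚ.* p′)
  ·-power {x} {y} {p} {p′} xᵏ yᵏ .below {r} (0<r , a , c , La , Lc , r<ac) =
    ℚ.<-trans (pow-mono-< k 0<r r<ac) (subst (ℚ._< p ℚ.* p′) (sym (pow-* a c k))
      (×-mono (pow-pos k (L-positive x La)) (positive yᵏ) (below xᵏ La) (below yᵏ Lc)))
  ·-power {x} {y} {p} {p′} xᵏ yᵏ .above {s} (b , d , Ub , Ud , bd<s) =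
    ℚ.<-trans (subst (p ℚ.* p′ ℚ.<_) (sym (pow-* b d k))
      (×-mono (positive xᵏ) (pow-pos k (U-positive y Ud)) (above xᵏ Ub) (above yᵏ Ud)))
      (pow-mono-< k (×-pos (U-positive x Ub) (U-positive y Ud)) bd<s)

  -- If r b < 1 for an upper bound b of x, then r^k p < (r b)^k < 1 = p′ p, and p cancels. The other
  -- side is dual.
  ⁻¹-power : ∀ {x p p′} → HasPower k x p → p′ ℚ.* p ≡ 1ℚ → HasPower k (x ⁻¹) p′
  ⁻¹-power {x} {p} {p′} xᵏ p′p≡1 .below {r} (0<r , b , Ub , rb<1) =
    *-cancel-< _ p′ p (positive xᵏ) (ℚ.<-trans (×-monoˡ (pow-pos k 0<r) (above xᵏ Ub))
      (subst₂ ℚ._<_ (pow-* r b k) (trans (pow-1 k) (sym p′p≡1))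
        (pow-mono-< k (×-pos 0<r (U-positive x Ub)) rb<1)))
  ⁻¹-power {x} {p} {p′} xᵏ p′p≡1 .above {s} (a , La , 1<sa) =
    *-cancel-< p′ _ p (positive xᵏ) (ℚ.<-trans
      (subst₂ ℚ._<_ (trans (pow-1 k) (sym p′p≡1)) (pow-* s a k) (pow-mono-< k 0<1 1<sa))
      (×-monoˡ (pow-pos k 0<s) (below xᵏ La)))
    where
    -- The upper cut of an inverse does not record positivity; it follows from 1 < s a and 0 < a.
    0<s : 0ℚ ℚ.< s
    0<s = *-cancel-< 0ℚ s a (L-positive x La)
      (subst (ℚ._< s ℚ.* a) (sym (ℚ.*-zeroˡ a)) (ℚ.<-trans 0<1 1<sa))

  ^ⁿ-power : ∀ {x p} n → HasPower k x p → HasPower k (x ^ⁿ n) (pow p n)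
  ^ⁿ-power         zero    xᵏ = subst (HasPower k (fromℚ 1ℚ 0<1)) (pow-1 k) (fromℚ-power {1ℚ} 0<1)
  ^ⁿ-power {x} {p} (suc n) xᵏ = ·-power {x} {x ^ⁿ n} {p} {pow p n} xᵏ (^ⁿ-power n xᵏ)

  -- The exponent z is presented as a difference m - n of naturals, and p^z is pinned down by p^z
  -- p^n = p^m. This treats both signs of z alike.
  ^-power : ∀ {x p} m n z → + m ≡ z + + n → HasPower k x p →
            ∃ λ p′ → HasPower k (x ^ z) p′ × p′ ℚ.* pow p n ≡ pow p m
  ^-power {x} {p} m n (+ z) m≡z+n xᵏ =
    pow p z , ^ⁿ-power {x} {p} z xᵏ , trans (sym (pow-+ p z n)) (cong (pow p) (sym (ℤ.+-injective m≡z+n)))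
  ^-power {x} {p} m n -[1+ z ] m≡z+n xᵏ =
    let xˢᵏ = ^ⁿ-power {x} {p} (suc z) xᵏ
        (p′ , _ , p′pˢ≡1) = recip (positive xˢᵏ)
    in p′ , ⁻¹-power {x ^ⁿ suc z} {pow p (suc z)} {p′} xˢᵏ p′pˢ≡1 , (begin
      p′ ℚ.* pow p n                          ≡⟨ cong (λ e → p′ ℚ.* pow p e) n≡ ⟩
      p′ ℚ.* pow p (suc z ℕ.+ m)              ≡⟨ cong (p′ ℚ.*_) (pow-+ p (suc z) m) ⟩
      p′ ℚ.* (pow p (suc z) ℚ.* pow p m)      ≡⟨ ℚ.*-assoc p′ _ _ ⟨
      p′ ℚ.* pow p (suc z) ℚ.* pow p m        ≡⟨ cong (ℚ._* pow p m) p′pˢ≡1 ⟩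
      1ℚ ℚ.* pow p m                          ≡⟨ ℚ.*-identityˡ _ ⟩
      pow p m                                 ∎)
    where
    open ≡-Reasoning
    n≡ : n ≡ suc z ℕ.+ m
    n≡ = ℤ.+-injective (begin
      + n                              ≡⟨ ℤ.+-identityˡ (+ n) ⟨
      + 0 + + n                        ≡⟨ cong (_+ + n) (ℤ.+-inverseʳ (+ suc z)) ⟨
      + suc z + -[1+ z ] + + n         ≡⟨ ℤ.+-assoc (+ suc z) -[1+ z ] (+ n) ⟩
      + suc z + (-[1+ z ] + + n)       ≡⟨ cong (_+_ (+ suc z)) m≡z+n ⟨
      + suc z + + m                    ∎)

-- A bound r of √x is a bound r² of x, and (r²)^k = r^(2k). Two nested roots therefore disappear in
-- the fourth power.
√-power : ∀ {k x p} → HasPower k x p → HasPower (k ℕ.+ k) (√ x) p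
√-power {k} {x} {p} xᵏ = record
  { below = λ {r} (_ , Lr²) → subst (ℚ._< p) (square r) (below xᵏ Lr²)
  ; above = λ {s} (_ , Us²) → subst (p ℚ.<_) (square s) (above xᵏ Us²)
  }
  where
  square : ∀ r → pow (r ℚ.* r) k ≡ pow r (k ℕ.+ k)
  square r = trans (pow-* r r k) (sym (pow-+ r k k))

-- Natural numbers as rationals.

ι : ℕ → ℚ
ι n = + n ℚ./ 1

toℚᵘ-ι : ∀ n → ℚ.toℚᵘ (ι n) ℚᵘ.≃ ℚᵘ.mkℚᵘ (+ n) 0
toℚᵘ-ι n = ℚ.toℚᵘ-fromℚᵘ (ℚᵘ.mkℚᵘ (+ n) 0)

ι-* : ∀ m n → ι (m ℕ.* n) ≡ ι m ℚ.* ι n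
ι-* m n = ℚ.toℚᵘ-injective (ℚᵘ.≃-trans (toℚᵘ-ι (m ℕ.* n)) (ℚᵘ.≃-trans
  (ℚᵘ.≃-reflexive (cong (λ i → ℚᵘ.mkℚᵘ i 0) (ℤ.pos-* m n)))
  (ℚᵘ.≃-sym (ℚᵘ.≃-trans (ℚ.toℚᵘ-homo-* (ι m) (ι n)) (ℚᵘ.*-cong (toℚᵘ-ι m) (toℚᵘ-ι n))))))

ι-^ : ∀ m n → ι (m ℕ.^ n) ≡ pow (ι m) n
ι-^ m zero    = refl
ι-^ m (suc n) = trans (ι-* m (m ℕ.^ n)) (cong (ι m ℚ.*_) (ι-^ m n))

ι-mono-≤ : ∀ {m n} → m ℕ.≤ n → ι m ℚ.≤ ι n
ι-mono-≤ {m} {n} m≤n = ℚ.toℚᵘ-cancel-≤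
  (ℚᵘ.≤-respˡ-≃ (ℚᵘ.≃-sym (toℚᵘ-ι m)) (ℚᵘ.≤-respʳ-≃ (ℚᵘ.≃-sym (toℚᵘ-ι n))
    (ℚᵘ.*≤* (ℤ.*-monoʳ-≤-nonNeg (+ 1) (+≤+ m≤n)))))

ι-pos : ∀ {n} .{{_ : ℕ.NonZero n}} → 0ℚ ℚ.< ι n
ι-pos {suc n} = 0</ {+ suc n} 1 (+<+ (ℕ.s≤s ℕ.z≤n))

-- Numerical estimates for a nearly even split.

^-distribʳ-* : ∀ m n o → (m ℕ.* n) ℕ.^ o ≡ m ℕ.^ o ℕ.* n ℕ.^ o
^-distribʳ-* m n zero    = refl
^-distribʳ-* m n (suc o) = trans (cong (m ℕ.* n ℕ.*_) (^-distribʳ-* m n o))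
  (lemma m n (m ℕ.^ o) (n ℕ.^ o))
  where
  lemma : ∀ m n x y → m ℕ.* n ℕ.* (x ℕ.* y) ≡ m ℕ.* x ℕ.* (n ℕ.* y)
  lemma = solve-∀

-- The exponents of a and of q are compared separately. With d = m - i, equal to 0 or 1, we have 4 i
-- m = n² - d, so the right side exceeds the left by 2 d in the exponent of a and by n - d = 2 i in
-- that of q. The factor q^(3 n) is the negative part of the exponent n (n - 3), moved across.
balanced-split-≤ : ∀ q a .{{_ : ℕ.NonZero q}} .{{_ : ℕ.NonZero a}} i m → m ≡ i ⊎ m ≡ suc i →
  let n = i ℕ.+ m in
  (a ℕ.* q) ℕ.^ (2 ℕ.* n) ℕ.* q ℕ.^ (n ℕ.* n) ℕ.≤ ((a ℕ.* q ℕ.^ i) ℕ.^ m) ℕ.^ 4 ℕ.* q ℕ.^ (3 ℕ.* n)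
balanced-split-≤ q a i m m≈i = begin
  (a ℕ.* q) ℕ.^ (2 ℕ.* n) ℕ.* q ℕ.^ (n ℕ.* n)
    ≡⟨ cong (ℕ._* q ℕ.^ (n ℕ.* n)) (^-distribʳ-* a q (2 ℕ.* n)) ⟩
  a ℕ.^ (2 ℕ.* n) ℕ.* q ℕ.^ (2 ℕ.* n) ℕ.* q ℕ.^ (n ℕ.* n)
    ≡⟨ collect a q (2 ℕ.* n) (2 ℕ.* n) (n ℕ.* n) ⟩
  a ℕ.^ (2 ℕ.* n) ℕ.* q ℕ.^ (2 ℕ.* n ℕ.+ n ℕ.* n)
    ≤⟨ ℕ.*-mono-≤ (ℕ.^-monoʳ-≤ a (a-exponent m≈i)) (ℕ.^-monoʳ-≤ q (q-exponent m≈i)) ⟩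
  a ℕ.^ (m ℕ.* 4) ℕ.* q ℕ.^ (i ℕ.* (m ℕ.* 4) ℕ.+ 3 ℕ.* n)
    ≡⟨ collect a q (m ℕ.* 4) (i ℕ.* (m ℕ.* 4)) (3 ℕ.* n) ⟨
  a ℕ.^ (m ℕ.* 4) ℕ.* q ℕ.^ (i ℕ.* (m ℕ.* 4)) ℕ.* q ℕ.^ (3 ℕ.* n)
    ≡⟨ cong (λ z → a ℕ.^ (m ℕ.* 4) ℕ.* z ℕ.* q ℕ.^ (3 ℕ.* n)) (ℕ.^-*-assoc q i (m ℕ.* 4)) ⟨
  a ℕ.^ (m ℕ.* 4) ℕ.* (q ℕ.^ i) ℕ.^ (m ℕ.* 4) ℕ.* q ℕ.^ (3 ℕ.* n)
    ≡⟨ cong (ℕ._* q ℕ.^ (3 ℕ.* n)) (^-distribʳ-* a (q ℕ.^ i) (m ℕ.* 4)) ⟨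
  (a ℕ.* q ℕ.^ i) ℕ.^ (m ℕ.* 4) ℕ.* q ℕ.^ (3 ℕ.* n)
    ≡⟨ cong (ℕ._* q ℕ.^ (3 ℕ.* n)) (ℕ.^-*-assoc (a ℕ.* q ℕ.^ i) m 4) ⟨
  ((a ℕ.* q ℕ.^ i) ℕ.^ m) ℕ.^ 4 ℕ.* q ℕ.^ (3 ℕ.* n) ∎
  where
  open ℕ.≤-Reasoning
  n = i ℕ.+ m
  collect : ∀ a q x y z → a ℕ.^ x ℕ.* q ℕ.^ y ℕ.* q ℕ.^ z ≡ a ℕ.^ x ℕ.* q ℕ.^ (y ℕ.+ z)
  collect a q x y z = trans (ℕ.*-assoc (a ℕ.^ x) _ _) (cong (a ℕ.^ x ℕ.*_) (sym (ℕ.^-distribˡ-+-* q y z)))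
  from-difference : ∀ {x y} d → x ℕ.+ d ≡ y → x ℕ.≤ y
  from-difference {x} d x+d≡y = subst (x ℕ.≤_) x+d≡y (ℕ.m≤m+n x d)
  a-exponent : ∀ {m} → m ≡ i ⊎ m ≡ suc i → 2 ℕ.* (i ℕ.+ m) ℕ.≤ m ℕ.* 4
  a-exponent (inj₁ refl) = from-difference 0 (lemma i)
    where
    lemma : ∀ i → 2 ℕ.* (i ℕ.+ i) ℕ.+ 0 ≡ i ℕ.* 4
    lemma = solve-∀
  a-exponent (inj₂ refl) = from-difference 2 (lemma i)
    where
    lemma : ∀ i → 2 ℕ.* (i ℕ.+ suc i) ℕ.+ 2 ≡ suc i ℕ.* 4
    lemma = solve-∀
  q-exponent : ∀ {m} → m ≡ i ⊎ m ≡ suc i →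
    2 ℕ.* (i ℕ.+ m) ℕ.+ (i ℕ.+ m) ℕ.* (i ℕ.+ m) ℕ.≤ i ℕ.* (m ℕ.* 4) ℕ.+ 3 ℕ.* (i ℕ.+ m)
  q-exponent (inj₁ refl) = from-difference (i ℕ.+ i) (lemma i)
    where
    lemma : ∀ i → 2 ℕ.* (i ℕ.+ i) ℕ.+ (i ℕ.+ i) ℕ.* (i ℕ.+ i) ℕ.+ (i ℕ.+ i) ≡ i ℕ.* (i ℕ.* 4) ℕ.+ 3 ℕ.* (i ℕ.+ i)
    lemma = solve-∀
  q-exponent (inj₂ refl) = from-difference (i ℕ.+ i) (lemma i)
    where
    lemma : ∀ i → 2 ℕ.* (i ℕ.+ suc i) ℕ.+ (i ℕ.+ suc i) ℕ.* (i ℕ.+ suc i) ℕ.+ (i ℕ.+ i)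
                  ≡ i ℕ.* (suc i ℕ.* 4) ℕ.+ 3 ℕ.* (i ℕ.+ suc i)
    lemma = solve-∀

-- For odd n the extra unit goes to m, since the exponent of a in `balanced-split-≤` requires n ≤ 2
-- m.
near-halves : ∀ n → ∃₂ λ i m → i ℕ.+ m ≡ n × (m ≡ i ⊎ m ≡ suc i)
near-halves zero    = 0 , 0 , refl , inj₁ refl
near-halves (suc n) with near-halves n
... | i , _ , i+m≡n , inj₁ refl = i , suc i , trans (ℕ.+-suc i i) (cong suc i+m≡n) , inj₂ refl
... | i , _ , i+m≡n , inj₂ refl = suc i , suc i , cong suc i+m≡n , inj₁ refl

-- Multiplying the two bounds on t gives t² ≤ 4 b e; squaring and dividing by 16 b² gives the claim.
-- It is the fourth power of t / (2 √b) ≤ √e, for t = a (q - 1) + 1, e = a q and b = B′.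
quotient-power-≤ : ∀ {t e b c} → 0ℚ ℚ.< t → t ℚ.≤ e → t ℚ.≤ ι 4 ℚ.* b → 0ℚ ℚ.< c →
  c ℚ.* (pow (ι 2) 4 ℚ.* pow b 2) ≡ 1ℚ → pow t 4 ℚ.* c ℚ.≤ pow e 2
quotient-power-≤ {t} {e} {b} {c} 0<t t≤e t≤4b 0<c c-inverse = begin
  pow t 4 ℚ.* c                                   ≡⟨ cong (ℚ._* c) (pow-+ t 2 2) ⟩
  pow t 2 ℚ.* pow t 2 ℚ.* c                       ≤⟨ ℚ.*-monoʳ-≤-nonNeg c {{ℚ.nonNegative (ℚ.<⇒≤ 0<c)}}
    (*-mono-≤-nonNeg (ℚ.<⇒≤ (pow-pos 2 0<t)) (ℚ.<⇒≤ (pow-pos 2 (ℚ.<-≤-trans 0<t t≤4b)))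
      (pow-mono-≤ 2 0<t t≤e) (pow-mono-≤ 2 0<t t≤4b)) ⟩
  pow e 2 ℚ.* pow (ι 4 ℚ.* b) 2 ℚ.* c             ≡⟨ solve 3 (λ e b c →
    e :* ((con (ι 4) :* b) :* ((con (ι 4) :* b) :* con 1ℚ)) :* c
      := c :* (con (pow (ι 2) 4) :* (b :* (b :* con 1ℚ))) :* e) refl (pow e 2) b c ⟩
  c ℚ.* (pow (ι 2) 4 ℚ.* pow b 2) ℚ.* pow e 2     ≡⟨ cong (ℚ._* pow e 2) c-inverse ⟩
  1ℚ ℚ.* pow e 2                                  ≡⟨ ℚ.*-identityˡ _ ⟩
  pow e 2                                         ∎
  where
  open ℚ.≤-Reasoning
  open +-*-Solver

-- From the integer sequence to natural numbers.

pos-^ : ∀ q n → (+ q) ℤ.^ n ≡ + (q ℕ.^ n)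
pos-^ q zero    = refl
pos-^ q (suc n) = trans (cong (+ q *_) (pos-^ q n)) (sym (ℤ.pos-* q (q ℕ.^ n)))

∣-lcmUpTo : ∀ (f : ℕ → ℤ) {j n} → j ℕ.< n → ℤ.∣ f (suc j) ∣ ℕ.∣ ℤ.∣ lcmUpTo f n ∣
∣-lcmUpTo f {j} {suc n} j<1+n with ℕ.m≤n⇒m<n∨m≡n (ℕ.s≤s⁻¹ j<1+n)
... | inj₁ j<n  = ℕ.∣-trans (∣-lcmUpTo f j<n) (ℕ.m∣lcm[m,n] ℤ.∣ lcmUpTo f n ∣ ℤ.∣ f (suc n) ∣)
... | inj₂ refl = ℕ.n∣lcm[m,n] ℤ.∣ lcmUpTo f n ∣ ℤ.∣ f (suc n) ∣

module Naturals (q a : ℕ) (b : ℤ) (2≤q : 2 ℕ.≤ q) (1≤a : 1 ℕ.≤ a) (-a≤b : - + a ≤ b) where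

  private instance
    q≢0 : ℕ.NonZero q
    q≢0 = ℕ.>-nonZero (ℕ.<⇒≤ 2≤q)
    a≢0 : ℕ.NonZero a
    a≢0 = ℕ.>-nonZero 1≤a

  -- As v_(n+1) = a (q^(n+1) - 1) + (a + b), a possibly negative b enters the terms through a + b,
  -- which is a natural number by -a ≤ b.
  open QSequence q a ℤ.∣ + a + b ∣

  +∣a+b∣ : + ℤ.∣ + a + b ∣ ≡ + a + b
  +∣a+b∣ = ℤ.0≤i⇒+∣i∣≡i (subst (_≤ + a + b) (ℤ.+-inverseʳ (+ a)) (ℤ.+-monoʳ-≤ (+ a) -a≤b))

  v≡u : ∀ n → v (+ q) (+ a) b (suc n) ≡ + u n
  v≡u n = begin
    + a * (+ q) ℤ.^ suc n + b                   ≡⟨ cong (λ x → + a * x + b) (trans (pos-^ q (suc n)) (cong +_ (suc-gap (suc n)))) ⟩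
    + a * (+ 1 + + g) + b                       ≡⟨ rearrange (+ a) (+ g) b ⟩
    + a * + g + (+ a + b)                       ≡⟨ cong₂ _+_ (ℤ.pos-* a g) +∣a+b∣ ⟨
    + (a ℕ.* g) + + ℤ.∣ + a + b ∣               ≡⟨ ℤ.pos-+ (a ℕ.* g) _ ⟨
    + u n                                       ∎
    where
    open ≡-Reasoning
    g = gap (suc n)
    rearrange : ∀ a g b → a * (+ 1 + g) + b ≡ a * g + (a + b)
    rearrange = solveℤ-∀

  aq+b≡u₀ : + a * + q + b ≡ + u 0
  aq+b≡u₀ = trans (cong (λ x → + a * x + b) (sym (ℤ.*-identityʳ (+ q)))) (v≡u 0)

  -- A common divisor of v_(n+1) and a q divides a q^(n+1), hence also b, and so gcd (a q, b).
  u-coprime : gcd (+ a * + q) b ≡ + 1 → ∀ n → Coprime (u n) (a ℕ.* q)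
  u-coprime gcd≡1 n {d} (d∣u , d∣aq) = ℕ.∣1⇒≡1 (subst (d ℕ.∣_) (ℤ.+-injective gcd≡1)
    (ℕ.gcd-greatest (subst (d ℕ.∣_) (sym (ℤ.abs-* (+ a) (+ q))) d∣aq) (ℤ.∣⇒∣ᵤ d∣b)))
    where
    d∣aqⁿ⁺¹ : + d ℤ.∣ + a * (+ q) ℤ.^ suc n
    d∣aqⁿ⁺¹ = subst (+ d ℤ.∣_)
      (trans (cong (_* (+ q) ℤ.^ n) (ℤ.pos-* a q)) (ℤ.*-assoc (+ a) (+ q) _))
      (ℤ.∣m⇒∣m*n {m = + (a ℕ.* q)} ((+ q) ℤ.^ n) (ℤ.∣ᵤ⇒∣ d∣aq))
    d∣b : + d ℤ.∣ b
    d∣b = ℤ.∣m+n∣m⇒∣n (subst (+ d ℤ.∣_) (sym (v≡u n)) (ℤ.∣ᵤ⇒∣ d∣u)) d∣aqⁿ⁺¹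

  a[q-1] : ℕ
  a[q-1] = a ℕ.* ℕ.pred q

  a[q-1]≡ : + a * (+ q - + 1) ≡ + a[q-1]
  a[q-1]≡ = trans (cong (λ x → + a * (+ x - + 1)) (sym (ℕ.suc-pred q))) (sym (ℤ.pos-* a (ℕ.pred q)))

  1≤a[q-1] : 1 ℕ.≤ a[q-1]
  1≤a[q-1] = ℕ.*-mono-≤ 1≤a (ℕ.pred-mono-≤ 2≤q)

  a[q-1]+1≤aq : suc a[q-1] ℕ.≤ a ℕ.* q
  a[q-1]+1≤aq = begin
    1 ℕ.+ a[q-1]              ≤⟨ ℕ.+-monoˡ-≤ a[q-1] 1≤a ⟩
    a ℕ.+ a ℕ.* ℕ.pred q      ≡⟨ ℕ.*-suc a (ℕ.pred q) ⟨
    a ℕ.* suc (ℕ.pred q)      ≡⟨ cong (a ℕ.*_) (ℕ.suc-pred q) ⟩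
    a ℕ.* q                   ∎
    where open ℕ.≤-Reasoning

  -- For x = a (q - 1) ≥ 1 we have 1 + x ≤ x + 3 x = 4 x, and x ≤ B′ as an entry of the maximum.
  a[q-1]+1≤4B′ : ι (suc a[q-1]) ℚ.≤ ι 4 ℚ.* B′ (+ q) (+ a) b
  a[q-1]+1≤4B′ = begin
    ι (suc a[q-1])            ≤⟨ ι-mono-≤ (ℕ.+-mono-≤ 1≤a[q-1] (ℕ.m≤n*m a[q-1] 3)) ⟩
    ι (4 ℕ.* a[q-1])          ≡⟨ ι-* 4 a[q-1] ⟩
    ι 4 ℚ.* ι a[q-1]          ≡⟨ cong (λ i → ι 4 ℚ.* (i ℚ./ 1)) a[q-1]≡ ⟨
    ι 4 ℚ.* ((+ a * (+ q - + 1)) ℚ./ 1)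
      ≤⟨ ℚ.*-monoˡ-≤-nonNeg (ι 4) (ℚ.p≤p⊔q ((+ a * (+ q - + 1)) ℚ./ 1) ((b * (+ q - + 1) + + 1) ℚ./ 2)) ⟩
    ι 4 ℚ.* B′ (+ q) (+ a) b  ∎
    where open ℚ.≤-Reasoning

  lcm-≥ : gcd (+ a * + q) b ≡ + 1 → ∀ {n i m} → ℤ.0ℤ ℤ.< lcmUpTo (v (+ q) (+ a) b) (suc n) → i ℕ.+ m ≡ n →
    u 0 ℕ.* (a ℕ.* q ℕ.^ i) ℕ.^ m ℕ.≤ ℤ.∣ lcmUpTo (v (+ q) (+ a) b) (suc n) ∣
  lcm-≥ gcd≡1 {n} {i} {m} 0<l i+m≡n = common-multiple-≥ 2≤q (u-coprime gcd≡1)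
    {{ℕ.≢-nonZero λ ∣l∣≡0 → ℤ.<⇒≢ 0<l (sym (ℤ.∣i∣≡0⇒i≡0 ∣l∣≡0))}} i m λ j j≤ →
      subst (λ x → ℤ.∣ x ∣ ℕ.∣ _) (v≡u j)
        (∣-lcmUpTo (v (+ q) (+ a) b) (ℕ.s≤s (subst (j ℕ.≤_) i+m≡n j≤)))

  -- Here p is q^(n² - 3 n), possibly a proper fraction. Multiplying by q^(3 n) and replacing c by
  -- (a q)² leaves an inequality of natural numbers, which follows from `balanced-split-≤` and the
  -- fourth power of the bound on l.
  fourth-power-common-multiple-≥ : ∀ n {i m l c p} → i ℕ.+ m ≡ n → m ≡ i ⊎ m ≡ suc i →
    u 0 ℕ.* (a ℕ.* q ℕ.^ i) ℕ.^ m ℕ.≤ l →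
    0ℚ ℚ.< c → c ℚ.≤ pow (ι (a ℕ.* q)) 2 →
    p ℚ.* pow (ι q) (3 ℕ.* n) ≡ pow (ι q) (n ℕ.* n) →
    pow (ι (u 0)) 4 ℚ.* pow c n ℚ.* p ℚ.≤ pow (ι l) 4
  fourth-power-common-multiple-≥ n {i} {m} {l} {c} {p} refl m≈i l≥ 0<c c≤ p≡ =
    ℚ.*-cancelʳ-≤-pos (pow (ι q) (3 ℕ.* n)) {{ℚ.positive (pow-pos (3 ℕ.* n) (ι-pos {q}))}} (begin
      pow (ι (u 0)) 4 ℚ.* pow c n ℚ.* p ℚ.* pow (ι q) (3 ℕ.* n)
        ≡⟨ trans (ℚ.*-assoc (pow (ι (u 0)) 4 ℚ.* pow c n) p _) (cong (pow (ι (u 0)) 4 ℚ.* pow c n ℚ.*_) p≡) ⟩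
      pow (ι (u 0)) 4 ℚ.* pow c n ℚ.* pow (ι q) (n ℕ.* n)
        ≤⟨ ℚ.*-monoʳ-≤-nonNeg (pow (ι q) (n ℕ.* n)) {{ℚ.nonNegative (ℚ.<⇒≤ (pow-pos (n ℕ.* n) (ι-pos {q})))}}
             (ℚ.*-monoˡ-≤-nonNeg (pow (ι (u 0)) 4)
               {{ℚ.nonNegative (subst (0ℚ ℚ.≤_) (ι-^ (u 0) 4) (ι-mono-≤ {0} {u 0 ℕ.^ 4} ℕ.z≤n))}}
               (pow-mono-≤ n 0<c c≤)) ⟩
      pow (ι (u 0)) 4 ℚ.* pow (pow (ι (a ℕ.* q)) 2) n ℚ.* pow (ι q) (n ℕ.* n)
        ≡⟨ cong (λ z → pow (ι (u 0)) 4 ℚ.* pow z n ℚ.* pow (ι q) (n ℕ.* n)) (ι-^ (a ℕ.* q) 2) ⟨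
      pow (ι (u 0)) 4 ℚ.* pow (ι ((a ℕ.* q) ℕ.^ 2)) n ℚ.* pow (ι q) (n ℕ.* n)
        ≡⟨ cong₂ ℚ._*_ (cong₂ ℚ._*_ (ι-^ (u 0) 4) (ι-^ ((a ℕ.* q) ℕ.^ 2) n)) (ι-^ q (n ℕ.* n)) ⟨
      ι (u 0 ℕ.^ 4) ℚ.* ι (((a ℕ.* q) ℕ.^ 2) ℕ.^ n) ℚ.* ι (q ℕ.^ (n ℕ.* n))
        ≡⟨ trans (ι-* (u 0 ℕ.^ 4 ℕ.* ((a ℕ.* q) ℕ.^ 2) ℕ.^ n) _) (cong (ℚ._* ι (q ℕ.^ (n ℕ.* n))) (ι-* (u 0 ℕ.^ 4) _)) ⟨
      ι (u 0 ℕ.^ 4 ℕ.* ((a ℕ.* q) ℕ.^ 2) ℕ.^ n ℕ.* q ℕ.^ (n ℕ.* n))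
        ≤⟨ ι-mono-≤ {u 0 ℕ.^ 4 ℕ.* ((a ℕ.* q) ℕ.^ 2) ℕ.^ n ℕ.* q ℕ.^ (n ℕ.* n)} {l ℕ.^ 4 ℕ.* q ℕ.^ (3 ℕ.* n)} integral ⟩
      ι (l ℕ.^ 4 ℕ.* q ℕ.^ (3 ℕ.* n))
        ≡⟨ trans (ι-* (l ℕ.^ 4) _) (cong₂ ℚ._*_ (ι-^ l 4) (ι-^ q (3 ℕ.* n))) ⟩
      pow (ι l) 4 ℚ.* pow (ι q) (3 ℕ.* n) ∎)
    where
    e = a ℕ.* q ℕ.^ i
    integral : u 0 ℕ.^ 4 ℕ.* ((a ℕ.* q) ℕ.^ 2) ℕ.^ n ℕ.* q ℕ.^ (n ℕ.* n) ℕ.≤ l ℕ.^ 4 ℕ.* q ℕ.^ (3 ℕ.* n)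
    integral = begin
      u 0 ℕ.^ 4 ℕ.* ((a ℕ.* q) ℕ.^ 2) ℕ.^ n ℕ.* q ℕ.^ (n ℕ.* n)
        ≡⟨ cong (λ z → u 0 ℕ.^ 4 ℕ.* z ℕ.* q ℕ.^ (n ℕ.* n)) (ℕ.^-*-assoc (a ℕ.* q) 2 n) ⟩
      u 0 ℕ.^ 4 ℕ.* (a ℕ.* q) ℕ.^ (2 ℕ.* n) ℕ.* q ℕ.^ (n ℕ.* n)
        ≡⟨ ℕ.*-assoc (u 0 ℕ.^ 4) _ _ ⟩
      u 0 ℕ.^ 4 ℕ.* ((a ℕ.* q) ℕ.^ (2 ℕ.* n) ℕ.* q ℕ.^ (n ℕ.* n))
        ≤⟨ ℕ.*-monoʳ-≤ (u 0 ℕ.^ 4) (balanced-split-≤ q a i m m≈i) ⟩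
      u 0 ℕ.^ 4 ℕ.* ((e ℕ.^ m) ℕ.^ 4 ℕ.* q ℕ.^ (3 ℕ.* n))
        ≡⟨ ℕ.*-assoc (u 0 ℕ.^ 4) _ _ ⟨
      u 0 ℕ.^ 4 ℕ.* (e ℕ.^ m) ℕ.^ 4 ℕ.* q ℕ.^ (3 ℕ.* n)
        ≡⟨ cong (ℕ._* q ℕ.^ (3 ℕ.* n)) (^-distribʳ-* (u 0) (e ℕ.^ m) 4) ⟨
      (u 0 ℕ.* e ℕ.^ m) ℕ.^ 4 ℕ.* q ℕ.^ (3 ℕ.* n)
        ≤⟨ ℕ.*-monoˡ-≤ (q ℕ.^ (3 ℕ.* n)) (ℕ.^-monoˡ-≤ 4 l≥) ⟩
      l ℕ.^ 4 ℕ.* q ℕ.^ (3 ℕ.* n) ∎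
      where open ℕ.≤-Reasoning
    open ℚ.≤-Reasoning

  -- c and p stand for 1 / (16 B′²) and q^((n + 1 - 1)(n + 1 - 4)), which need not be an integer.
  fourth-power-boundℕ : gcd (+ a * + q) b ≡ + 1 → ∀ n → let l = lcmUpTo (v (+ q) (+ a) b) (suc n) in ℤ.0ℤ ℤ.< l →
    ∀ {w x y z c p} → w ≡ ι (u 0) → x ≡ ι (suc a[q-1]) → y ≡ ι q → z ≡ ι ℤ.∣ l ∣ →
    0ℚ ℚ.< c → c ℚ.* (pow (ι 2) 4 ℚ.* pow (B′ (+ q) (+ a) b) 2) ≡ 1ℚ →
    p ℚ.* pow y (3 ℕ.* n) ≡ pow y (n ℕ.* n) →
    pow w 4 ℚ.* pow (pow x 4 ℚ.* c) n ℚ.* p ℚ.≤ pow z 4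
  fourth-power-boundℕ gcd≡1 n 0<l {c = c} {p} refl refl refl refl 0<c c-inverse p≡ =
    let (i , m , i+m≡n , m≈i) = near-halves n
    in fourth-power-common-multiple-≥ n {i} {m} {ℤ.∣ lcmUpTo (v (+ q) (+ a) b) (suc n) ∣}
      {pow (ι (suc a[q-1])) 4 ℚ.* c} {p} i+m≡n m≈i
      (lcm-≥ gcd≡1 {n} {i} {m} 0<l i+m≡n)
      (×-pos {pow (ι (suc a[q-1])) 4} {c} (pow-pos {ι (suc a[q-1])} 4 (ι-pos {suc a[q-1]})) 0<c)
      (quotient-power-≤ {ι (suc a[q-1])} {ι (a ℕ.* q)} {B′ (+ q) (+ a) b} {c} (ι-pos {suc a[q-1]})
        (ι-mono-≤ {suc a[q-1]} {a ℕ.* q} a[q-1]+1≤aq) a[q-1]+1≤4B′ 0<c c-inverse)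
      p≡

-- Fourth powers of the real bound.

-- Since n - 4 = (n - 1) - 3, the exponent is (n - 1)² - 3 (n - 1), a difference of naturals as
-- `^-power` expects.
exponent : ∀ n → 1 ℕ.≤ n →
  + (ℕ.pred n ℕ.* ℕ.pred n) ≡ (+ n - + 1) * (+ n - + 4) + + (3 ℕ.* ℕ.pred n)
exponent (suc n) _ = trans (ℤ.pos-* n n) (trans (lemma (+ n))
  (cong (λ x → (+ suc n - + 1) * (+ suc n - + 4) + x) (sym (ℤ.pos-* 3 n))))
  where
  lemma : ∀ n → n * n ≡ (+ 1 + n - + 1) * (+ 1 + n - + 4) + + 3 * n
  lemma = solveℤ-∀

module _ {k : ℕ} .{{_ : ℕ.NonZero k}} where

  fromℤ-power : ∀ {i} (0<i : ℤ.0ℤ ℤ.< i) → HasPower k (fromℤ i 0<i) (pow (i ℚ./ 1) k)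
  fromℤ-power {i} 0<i = fromℚ-power {x = i ℚ./ 1} (0</ {i} 1 0<i)

  ÷-power : ∀ {x y p p′ d} → HasPower k x p → HasPower k y p′ → d ℚ.* p′ ≡ 1ℚ → HasPower k (x ÷ y) (p ℚ.* d)
  ÷-power {x} {y} {p} {p′} {d} xᵏ yᵏ d-inverse =
    ·-power {x = x} {y = y ⁻¹} {p = p} {p′ = d} xᵏ (⁻¹-power {x = y} yᵏ d-inverse)

-- The fourth power of 2 √x is 16 x², so c is 1 / (16 x²).
ratio-power : ∀ {i x} (0<i : ℤ.0ℤ ℤ.< i) (0<x : 0ℚ ℚ.< x) → ∃ λ c →
  0ℚ ℚ.< c × c ℚ.* (pow (ι 2) 4 ℚ.* pow x 2) ≡ 1ℚ ×
  HasPower 4 (fromℤ i 0<i ÷ (fromℤ (+ 2) 0<2 · √ fromℚ x 0<x)) (pow (i ℚ./ 1) 4 ℚ.* c)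
ratio-power {i} {x} 0<i 0<x =
  let (c , 0<c , c-inverse) = recip (×-pos {pow (ι 2) 4} {pow x 2} (pow-pos {ι 2} 4 (ι-pos {2})) (pow-pos {x} 2 0<x))
  in c , 0<c , c-inverse , ÷-power {4} {fromℤ i 0<i} {fromℤ (+ 2) 0<2 · √ fromℚ x 0<x}
       (fromℤ-power {4} {i} 0<i)
       (·-power {4} {fromℤ (+ 2) 0<2} {√ fromℚ x 0<x} (fromℤ-power {4} {+ 2} 0<2)
         (√-power {2} {fromℚ x 0<x} {pow x 2} (fromℚ-power {2} {x} 0<x)))
       c-inverse

fourth-root-power : ∀ {i} (0<i : ℤ.0ℤ ℤ.< i) → HasPower 4 (√ √ fromℤ i 0<i) (i ℚ./ 1)
fourth-root-power {i} 0<i = √-power {2} {√ fromℤ i 0<i} {i ℚ./ 1} (√-power {1} {fromℤ i 0<i} {i ℚ./ 1}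
  (subst (HasPower 1 (fromℤ i 0<i)) (ℚ.*-identityʳ (i ℚ./ 1)) (fromℤ-power {1} {i} 0<i)))

-- Membership in L or U of a compound real does not involve the positivity proofs inside it, so
-- these may be exchanged with Ly⊆Lx and Uy⊆Ux the identity.
recast : ∀ {k x y p} → (∀ {r} → L y r → L x r) → (∀ {s} → U y s → U x s) → HasPower k x p → HasPower k y p
recast Ly⊆Lx Uy⊆Ux xᵏ .below Lr = below xᵏ (Ly⊆Lx Lr)
recast Ly⊆Lx Uy⊆Ux xᵏ .above Us = above xᵏ (Uy⊆Ux Us)

-- A rational r below the product has r^4 below the fourth power of the product, hence r^4 < h^4 and
-- r < h. The bound is asked for every p with p t^l = t^k because the value of y^z to the fourth is
-- known through this equation.
L-by-powers : ∀ {h i} (0<h : ℤ.0ℤ ℤ.< h) (0<i : ℤ.0ℤ ℤ.< i) n → 1 ℕ.≤ n → ∀ k l z → + k ≡ z + + l →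
  ∀ {x y r e t} → L (fromℤ i 0<i · x ^ (+ n - + 1) · y ^ z) r →
  HasPower 4 x e → HasPower 4 y t →
  (∀ {p} → p ℚ.* pow t l ≡ pow t k → pow (i ℚ./ 1) 4 ℚ.* pow e (ℕ.pred n) ℚ.* p ℚ.≤ pow (h ℚ./ 1) 4) →
  L (fromℤ h 0<h) r
-- Matching on `suc n` lets `+ suc n - + 1` compute to `+ n`, so the integer power of x becomes
-- `x ^ⁿ n`.
L-by-powers {h} {i} 0<h 0<i (suc n) _ k l z k≡z+l {x} {y} {r} {e} {t} Lr x⁴ y⁴ bound =
  let (p , yᶻ⁴ , p≡) = ^-power {4} {x = y} {p = t} k l z k≡z+l y⁴
      rhs⁴ = ·-power {4} {x = fromℤ i 0<i · x ^ⁿ n} {y = y ^ z} {p = pow (i ℚ./ 1) 4 ℚ.* pow e n} {p′ = p}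
        (·-power {4} {x = fromℤ i 0<i} {y = x ^ⁿ n} {p = pow (i ℚ./ 1) 4} {p′ = pow e n}
          (fromℤ-power {4} {i} 0<i) (^ⁿ-power {4} {x} {e} n x⁴)) yᶻ⁴
  in L-positive (fromℤ i 0<i · x ^ⁿ n · y ^ z) Lr ,
     pow-cancel-< 4 (0</ {h} 1 0<h) (ℚ.<-≤-trans (below rhs⁴ Lr) (bound p≡))

fourth-power-bound : ∀ q a b → + 2 ≤ q → + 1 ≤ a → - a ≤ b → gcd (a * q) b ≡ + 1 →
  ∀ n → 1 ℕ.≤ n → ℤ.0ℤ ℤ.< lcmUpTo (v q a b) n →
  ∀ {c p} → 0ℚ ℚ.< c → c ℚ.* (pow (ι 2) 4 ℚ.* pow (B′ q a b) 2) ≡ 1ℚ →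
  p ℚ.* pow (q ℚ./ 1) (3 ℕ.* ℕ.pred n) ≡ pow (q ℚ./ 1) (ℕ.pred n ℕ.* ℕ.pred n) →
  pow ((a * q + b) ℚ./ 1) 4 ℚ.* pow (pow ((a * (q - + 1) + + 1) ℚ./ 1) 4 ℚ.* c) (ℕ.pred n) ℚ.* p
    ℚ.≤ pow (lcmUpTo (v q a b) n ℚ./ 1) 4
fourth-power-bound (+ q) (+ a) b 2≤q 1≤a -a≤b gcd≡1 (suc n) _ 0<l =
  fourth-power-boundℕ gcd≡1 n 0<l
    (cong (ℚ._/ 1) aq+b≡u₀)
    (cong (ℚ._/ 1) (trans (cong (_+ + 1) a[q-1]≡) (ℤ.+-comm (+ a[q-1]) (+ 1))))
    refl
    (cong (ℚ._/ 1) (sym (ℤ.0≤i⇒+∣i∣≡i (ℤ.<⇒≤ 0<l))))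
  where open Naturals q a b (ℤ.drop‿+≤+ 2≤q) (ℤ.drop‿+≤+ 1≤a) -a≤b
fourth-power-bound (+ _) -[1+ _ ] b _ ()
fourth-power-bound -[1+ _ ] a b ()

corollary1p5 : (q a b : ℤ) (2≤q : + 2 ≤ q) (1≤a : + 1 ≤ a) (-a≤b : - a ≤ b) →
    gcd (a * q) b ≡ + 1 → gcd (a + b) (q - + 1) ≡ + 1 →
    (n : ℕ) → 1 ℕ.≤ n →
    let open Positivity q a b 2≤q 1≤a -a≤b in
    fromℤ (lcmUpTo (v q a b) n) (0<lcm n)
    ≥ᴿ
    fromℤ (a * q + b) 0<aq+b
    · (fromℤ (a * (q - + 1) + + 1) 0<a[q-1]+1 ÷ (fromℤ (+ 2) 0<2 · √ fromℚ (B′ q a b) 0<B′)) ^ (+ n - + 1)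
    · (√ √ fromℤ q 0<q) ^ ((+ n - + 1) * (+ n - + 4))
corollary1p5 q a b 2≤q 1≤a -a≤b gcd≡1 _ n 1≤n {r} Lr =
  let (c , 0<c , c-inverse , x⁴) = ratio-power 0<a[q-1]+1 0<B′
      y⁴ = fourth-root-power 0<q
  in L-by-powers (0<lcm n) 0<aq+b n 1≤n
       (ℕ.pred n ℕ.* ℕ.pred n) (3 ℕ.* ℕ.pred n) ((+ n - + 1) * (+ n - + 4)) (exponent n 1≤n) Lr
       (recast id id x⁴) (recast id id y⁴)
       (λ {p} → fourth-power-bound q a b 2≤q 1≤a -a≤b gcd≡1 n 1≤n (0<lcm n) {c} {p} 0<c c-inverse)
  where open Positivity q a b 2≤q 1≤a -a≤b
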